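{- Let $P_{(2,1)}$ be the set of all cylindric partitions with profile $c=(2,1)$. Then, as formal power series in $q$, $$\sum_{\Lambda\in P_{(2,1)}} q^{|\Lambda|}=\left(\sum_{n\ge0}\frac{q^{n^2}}{(q^4;q^4)_n}\right)\frac{(-q^2;q^2)_\infty}{(q;q)_\infty}.$$
   Context: Let $r,\ell$ be positive integers and $c=(c_1,\dots,c_r)$ a composition of $\ell$ into $r$ nonnegative integer parts (zero entries allowed). A cylindric partition with profile $c$ is a tuple $\Lambda=(\lambda^{(1)},\dots,\lambda^{(r)})$ of ordinary partitions $\lambda^{(i)}=(\lambda^{(i)}_1\ge\lambda^{(i)}_2\ge\cdots)$ (parts beyond the length are taken to be $0$) such that for all $i,j$: $\lambda^{(i)}_j\ge\lambda^{(i+1)}_{j+c_{i+1}}$ for $1\le i\le r-1$, and $\lambda^{(r)}_j\ge\lambda^{(1)}_{j+c_1}$. The size $|\Lambda|$ is the sum of all parts of all $\lambda^{(i)}$; the empty cylindric partition is included with size $0$. Notation: $(a;q)_n=\prod_{k=1}^n(1-aq^{k-1})$, $(a;q)_\infty=\lim_{n\to\infty}(a;q)_n$. -}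

module Defs where

open import Data.Nat as ℕ using (ℕ; zero; suc; _∸_; _≥_; _<_)
open import Data.Integer as ℤ using (ℤ; +_; -_)
open import Data.List using (List; []; _∷_; _++_; [_]; length)
open import Data.List.Relation.Unary.All using (All)
open import Data.List.Relation.Unary.Linked using (Linked)
open import Data.Vec using (Vec; lookup) renaming ([] to []ᵥ; _∷_ to _∷ᵥ_)
open import Data.Fin as Fin using (Fin)
open import Data.Product using (_×_)
open import Relation.Nullary using (yes; no)

IsPartition : List ℕ → Set
IsPartition λs = Linked _≥_ λs × All (0 <_) λs

part : List ℕ → ℕ → ℕ
part []       _       = 0
part (x ∷ xs) zero    = x
part (x ∷ xs) (suc j) = part xs j

sumℕ : List ℕ → ℕ
sumℕ []       = 0
sumℕ (x ∷ xs) = x ℕ.+ sumℕ xs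

-- Cylindric partitions with profile c = (c_1,…,c_r), r ≥ 1 (so r = suc k).
-- Components indexed by Fin (suc k); component i+1 (cyclically) is `next i`.

next : ∀ {k} → Fin (suc k) → Fin (suc k)
next {k} i with Fin.toℕ i ℕ.<? k
... | yes p = Fin.fromℕ< (ℕ.s≤s p)
... | no _  = Fin.zero

IsCylindric : ∀ {k} → Vec ℕ (suc k) → Vec (List ℕ) (suc k) → Set
IsCylindric {k} c Λ =
  ((i : Fin (suc k)) → IsPartition (lookup Λ i)) ×
  ((i : Fin (suc k)) (j : ℕ) →
     part (lookup Λ i) j ≥ part (lookup Λ (next i)) (j ℕ.+ lookup c (next i)))

sizeCyl : ∀ {n} → Vec (List ℕ) n → ℕ
sizeCyl []ᵥ = 0
sizeCyl (λs ∷ᵥ Λ) = sumℕ λs ℕ.+ sizeCyl Λ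

Series : Set
Series = ℕ → ℤ

sumTo : (ℕ → ℤ) → ℕ → ℤ
sumTo f zero    = + 0
sumTo f (suc n) = sumTo f n ℤ.+ f n

one : Series
one zero    = + 1
one (suc _) = + 0

mono : ℕ → Series
mono zero    zero    = + 1
mono zero    (suc _) = + 0
mono (suc k) zero    = + 0
mono (suc k) (suc n) = mono k n

_⊕_ : Series → Series → Series
(f ⊕ g) n = f n ℤ.+ g n

neg : Series → Series
neg f n = - f n

_⊛_ : Series → Series → Series
(f ⊛ g) n = sumTo (λ i → f i ℤ.* g (n ∸ i)) (suc n)

infixl 7 _⊛_
infixl 6 _⊕_

spow : Series → ℕ → Series
spow f zero    = one
spow f (suc k) = spow f k ⊛ f

poch : Series → Series → ℕ → Series
poch a b zero    = one
poch a b (suc n) = poch a b n ⊛ (one ⊕ neg (a ⊛ spow b n))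

-- (a;b)_∞ for a, b without constant term: the N-th coefficient of the
-- infinite product equals that of the partial product with N+1 factors
-- (factor k is 1 + O(q^{k+1})).
pochInf : Series → Series → Series
pochInf a b N = poch a b (suc N) N

-- Infinite sum ∑_{n≥0} f n of series where f n = O(q^n):
-- the N-th coefficient only receives contributions from n ≤ N.
sumInf : (ℕ → Series) → Series
sumInf f N = sumTo (λ n → f n N) (suc N)

-- Multiplicative inverse of a series with constant term 1:
-- b_0 = 1, b_m = - ∑_{i=1}^{m} a_i b_{m-i}.
at : List ℤ → ℕ → ℤ
at []       _       = + 0
at (x ∷ xs) zero    = x
at (x ∷ xs) (suc j) = at xs j

invUpTo : Series → ℕ → List ℤ
invUpTo a zero    = [ + 1 ]
invUpTo a (suc m) =
  let bs = invUpTo a m in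
  bs ++ [ - sumTo (λ i → a (suc i) ℤ.* at bs (m ∸ i)) (suc m) ]

inv : Series → Series
inv a m = at (invUpTo a m) m

rhs41 : Series
rhs41 =
  sumInf (λ n → mono (n ℕ.* n) ⊛ inv (poch (mono 4) (mono 4) n))
  ⊛ pochInf (neg (mono 2)) (mono 2)
  ⊛ inv (pochInf (mono 1) (mono 1))

module Submission where

-- Where the formulas for A_M and B_M come from: with A(z) = Σ A_M z^M and B(z) = Σ B_M z^M the
-- recurrences read (1-z)A(z) = A(qz) + qz B(qz) and (1-z)B(z) = A(qz). The substitution A = G V, B
-- = H V with V(z) = 1/(z;q)_∞, for which (1-z)V(z) = V(qz), leaves H(z) = G(qz) and G(z) = G(qz) +
-- qz G(q²z), the Rogers-Ramanujan equation, solved by G(z) = Σ q^{n²} z^n/(q;q)_n. Two kinds of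
-- series therefore occur: series in z, whose coefficients are series in q. The theory of Cauchy
-- products is developed over an arbitrary commutative ring and used for both. No limits are taken.
-- The coefficient of q^N is computed in the quotient of the q-series by q^{N+1}, where q^n is zero
-- for n > N; there infinite sums and products become finite ones and Rogers' identity an identity
-- of ring elements. The profiles (2,1) and (3,0) suffice because exchanging the two components
-- turns (1,2) into (2,1).

-- Let A_M and B_M be the generating functions of the cylindric partitions of profile (2,1) and
-- (3,0) with parts at most M. Removing a largest part M gives A_M = A_{M-1} + q^M A_M + q^M B_{M-1}
-- and B_M = B_{M-1} + q^M A_M, which are solved by A_M = Σ_n q^{n²}/((q;q)_n (q;q)_{M-n}) and
-- B_M = Σ_n q^{n²+n}/((q;q)_n (q;q)_{M-n}). Modulo q^{N+1}, A_N equals Σ_n q^{n²}/(q;q)_n · 1/(q;q)_∞.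
-- Rogers' identity Σ q^{n²}/(q;q)_n = (-q²;q²)_∞ Σ q^{n²}/(q⁴;q⁴)_n follows by expanding
-- (-q^{2n+2};q²)_∞ with Euler's formula and collecting the terms of the double sum along
-- diagonals, where Σ_{n+m=k} q^m/((q²;q²)_n (q²;q²)_m) = 1/(q;q)_k.

open import Defs
open import Data.Nat using (ℕ)
open import Data.Integer using (+_)
open import Data.List using (List; length)
open import Data.List.Relation.Unary.All using (All)
open import Data.List.Relation.Unary.Unique.Propositional using (Unique)
open import Data.List.Membership.Propositional using (_∈_)
open import Data.Vec using (Vec; []; _∷_)
open import Data.Product using (Σ; _×_)
open import Relation.Binary.PropositionalEquality using (_≡_)

open import Algebra.Bundles using (CommutativeRing)
import Algebra.Properties.Ring as RingProperties
import Algebra.Solver.Ring.NaturalCoefficients.Default as SemiringSolver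
open import Data.Empty using (⊥; ⊥-elim)
open import Data.Fin as Fin using ()
open import Data.Integer as ℤ using (ℤ)
open import Data.Integer.Properties as ℤₚ using ()
import Data.List as List
import Data.List.Membership.Propositional.Properties as ∈ₚ
import Data.List.Properties as Listₚ
import Data.List.Relation.Unary.All as All
import Data.List.Relation.Unary.All.Properties as Allₚ
import Data.List.Relation.Unary.AllPairs as AllPairs
open import Data.List.Relation.Unary.Any using (here)
import Data.List.Relation.Unary.Linked as Linked
import Data.List.Relation.Unary.Unique.Propositional.Properties as Uniqueₚ
open import Data.Nat as ℕ using (zero; suc; _∸_; _≤_; _<_; z≤n; s≤s)
open import Data.Nat.Induction using (<-rec)
open import Data.Nat.Properties as ℕₚ using ()
import Data.Nat.Solver as ℕSolver
open import Data.Product using (∃; _,_; proj₁; proj₂)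
open import Data.Sum using (_⊎_; inj₁; inj₂; [_,_]′)
open import Function using (_∘_)
open import Level using (0ℓ)
import Relation.Binary.PropositionalEquality as ≡
import Relation.Binary.Reasoning.Setoid as SetoidReasoning
open import Relation.Nullary using (¬_; yes; no)

-- Finite sums and Cauchy products over a commutative ring.

module Sequences {c ℓ} (R : CommutativeRing c ℓ) where
  open CommutativeRing R
  open SetoidReasoning setoid
  open SemiringSolver commutativeSemiring

  infixl 7 _⋆_
  infix 4 _≐_

  Sequence : Set c
  Sequence = ℕ → Carrier

  _≐_ : Sequence → Sequence → Set ℓ
  f ≐ g = ∀ n → f n ≈ g n

  ∑ : Sequence → ℕ → Carrier
  ∑ f zero    = 0#
  ∑ f (suc n) = ∑ f n + f n

  ∑-cong : ∀ {f g} n → (∀ i → i < n → f i ≈ g i) → ∑ f n ≈ ∑ g n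
  ∑-cong zero    h = refl
  ∑-cong (suc n) h =
    +-cong (∑-cong n λ i i<n → h i (ℕₚ.m<n⇒m<1+n i<n)) (h n (ℕₚ.n<1+n n))

  ∑-vanish : ∀ {f} n → (∀ i → i < n → f i ≈ 0#) → ∑ f n ≈ 0#
  ∑-vanish zero    h = refl
  ∑-vanish (suc n) h = trans
    (+-cong (∑-vanish n λ i i<n → h i (ℕₚ.m<n⇒m<1+n i<n)) (h n (ℕₚ.n<1+n n)))
    (+-identityˡ 0#)

  ∑-+ : ∀ f g n → ∑ (λ i → f i + g i) n ≈ ∑ f n + ∑ g n
  ∑-+ f g zero    = sym (+-identityˡ 0#)
  ∑-+ f g (suc n) = trans (+-congʳ (∑-+ f g n))
    (solve 4 (λ a b x y → (a :+ b) :+ (x :+ y) := (a :+ x) :+ (b :+ y)) refl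
      (∑ f n) (∑ g n) (f n) (g n))

  ∑-*ˡ : ∀ x f n → x * ∑ f n ≈ ∑ (λ i → x * f i) n
  ∑-*ˡ x f zero    = zeroʳ x
  ∑-*ˡ x f (suc n) = trans (distribˡ x _ _) (+-congʳ (∑-*ˡ x f n))

  ∑-*ʳ : ∀ x f n → ∑ f n * x ≈ ∑ (λ i → f i * x) n
  ∑-*ʳ x f zero    = zeroˡ x
  ∑-*ʳ x f (suc n) = trans (distribʳ x _ _) (+-congʳ (∑-*ʳ x f n))

  ∑-head : ∀ f n → ∑ f (suc n) ≈ f 0 + ∑ (f ∘ suc) n
  ∑-head f zero    = +-comm 0# (f 0)
  ∑-head f (suc n) = trans (+-congʳ (∑-head f n)) (+-assoc _ _ _)

  ∑-extend : ∀ {f m} n → m ≤ n → (∀ i → m ≤ i → f i ≈ 0#) → ∑ f m ≈ ∑ f n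
  ∑-extend n m≤n h with ℕₚ.m≤n⇒m<n∨m≡n m≤n
  ... | inj₂ ≡.refl = refl
  ∑-extend (suc n) m≤n h | inj₁ (s≤s m≤n′) =
    trans (∑-extend n m≤n′ h) (sym (trans (+-congˡ (h n m≤n′)) (+-identityʳ _)))

  -- `t` lives on i + j < K, so its diagonals and its rows exhaust the same entries. The induction
  -- peels off row 0, after which the support shrinks to i + j < K - 1 while the rows keep their
  -- length; this is why `L` is separate from `K`.
  ∑-triangle : ∀ (t : ℕ → ℕ → Carrier) {L} K → K ≤ L →
    (∀ i j → K ≤ i ℕ.+ j → t i j ≈ 0#) →
    ∑ (λ N → ∑ (λ i → t i (N ∸ i)) (suc N)) K ≈ ∑ (λ i → ∑ (t i) L) K
  ∑-triangle t zero    _   h = refl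
  ∑-triangle t {L} (suc K) K<L h = begin
    ∑ (λ N → ∑ (λ i → t i (N ∸ i)) (suc N)) (suc K)
      ≈⟨ ∑-cong (suc K) (λ N _ → ∑-head (λ i → t i (N ∸ i)) N) ⟩
    ∑ (λ N → t 0 N + ∑ (λ i → t (suc i) (N ∸ suc i)) N) (suc K)
      ≈⟨ ∑-+ (t 0) (λ N → ∑ (λ i → t (suc i) (N ∸ suc i)) N) (suc K) ⟩
    ∑ (t 0) (suc K) + ∑ (λ N → ∑ (λ i → t (suc i) (N ∸ suc i)) N) (suc K)
      ≈⟨ +-cong (∑-extend L K<L (h 0)) (∑-head (λ N → ∑ (λ i → t (suc i) (N ∸ suc i)) N) K) ⟩
    ∑ (t 0) L + (0# + ∑ (λ N → ∑ (λ i → t (suc i) (N ∸ i)) (suc N)) K)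
      ≈⟨ +-congˡ (trans (+-identityˡ _)
           (∑-triangle (t ∘ suc) K (ℕₚ.<⇒≤ K<L) λ i j K≤ → h (suc i) j (s≤s K≤))) ⟩
    ∑ (t 0) L + ∑ (λ i → ∑ (t (suc i)) L) K
      ≈⟨ ∑-head (λ i → ∑ (t i) L) K ⟨
    ∑ (λ i → ∑ (t i) L) (suc K) ∎

  _⋆_ : Sequence → Sequence → Sequence
  (f ⋆ g) n = ∑ (λ i → f i * g (n ∸ i)) (suc n)

  ⋆-head : ∀ f g → (f ⋆ g) 0 ≈ f 0 * g 0
  ⋆-head f g = +-identityˡ _

  ⋆-sucˡ : ∀ f g n → (f ⋆ g) (suc n) ≈ f 0 * g (suc n) + ((f ∘ suc) ⋆ g) n
  ⋆-sucˡ f g n = ∑-head (λ i → f i * g (suc n ∸ i)) (suc n)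

  ⋆-sucʳ : ∀ f g n → (f ⋆ g) (suc n) ≈ (f ⋆ (g ∘ suc)) n + f (suc n) * g 0
  ⋆-sucʳ f g n = +-cong
    (∑-cong (suc n) λ { i (s≤s i≤n) →
      *-congˡ (reflexive (≡.cong g (ℕₚ.+-∸-assoc 1 i≤n))) })
    (*-congˡ (reflexive (≡.cong g (ℕₚ.n∸n≡0 n))))

  ⋆-cong-≤ : ∀ {f f′ g g′} n → (∀ i → i ≤ n → f i ≈ f′ i) → (∀ i → i ≤ n → g i ≈ g′ i) →
    (f ⋆ g) n ≈ (f′ ⋆ g′) n
  ⋆-cong-≤ n hf hg = ∑-cong (suc n) λ { i (s≤s i≤n) → *-cong (hf i i≤n) (hg (n ∸ i) (ℕₚ.m∸n≤m n i)) }

  ⋆-cong : ∀ {f f′ g g′} → f ≐ f′ → g ≐ g′ → f ⋆ g ≐ f′ ⋆ g′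
  ⋆-cong hf hg n = ⋆-cong-≤ n (λ i _ → hf i) (λ i _ → hg i)

  ⋆-congˡ : ∀ f {g g′} → g ≐ g′ → f ⋆ g ≐ f ⋆ g′
  ⋆-congˡ f h = ⋆-cong {f} (λ _ → refl) h

  ⋆-congʳ : ∀ {f f′} g → f ≐ f′ → f ⋆ g ≐ f′ ⋆ g
  ⋆-congʳ g h = ⋆-cong {g = g} h (λ _ → refl)

  ⋆-comm : ∀ f g → f ⋆ g ≐ g ⋆ f
  ⋆-comm f g zero    = +-congˡ (*-comm (f 0) (g 0))
  ⋆-comm f g (suc n) = begin
    (f ⋆ g) (suc n)                        ≈⟨ ⋆-sucˡ f g n ⟩
    f 0 * g (suc n) + ((f ∘ suc) ⋆ g) n    ≈⟨ +-cong (*-comm _ _) (⋆-comm (f ∘ suc) g n) ⟩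
    g (suc n) * f 0 + (g ⋆ (f ∘ suc)) n    ≈⟨ +-comm _ _ ⟩
    (g ⋆ (f ∘ suc)) n + g (suc n) * f 0    ≈⟨ ⋆-sucʳ g f n ⟨
    (g ⋆ f) (suc n)                        ∎

  ⋆-distribʳ : ∀ h f g n → ((λ i → f i + g i) ⋆ h) n ≈ (f ⋆ h) n + (g ⋆ h) n
  ⋆-distribʳ h f g n = trans
    (∑-cong (suc n) λ i _ → distribʳ (h (n ∸ i)) (f i) (g i))
    (∑-+ (λ i → f i * h (n ∸ i)) (λ i → g i * h (n ∸ i)) (suc n))

  ⋆-distribˡ : ∀ f g h n → (f ⋆ (λ i → g i + h i)) n ≈ (f ⋆ g) n + (f ⋆ h) n
  ⋆-distribˡ f g h n = begin
    (f ⋆ (λ i → g i + h i)) n  ≈⟨ ⋆-comm f _ n ⟩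
    ((λ i → g i + h i) ⋆ f) n  ≈⟨ ⋆-distribʳ f g h n ⟩
    (g ⋆ f) n + (h ⋆ f) n      ≈⟨ +-cong (⋆-comm g f n) (⋆-comm h f n) ⟩
    (f ⋆ g) n + (f ⋆ h) n      ∎

  ⋆-scaleˡ : ∀ x f g n → ((λ i → x * f i) ⋆ g) n ≈ x * (f ⋆ g) n
  ⋆-scaleˡ x f g n = trans
    (∑-cong (suc n) λ i _ → *-assoc x (f i) (g (n ∸ i)))
    (sym (∑-*ˡ x (λ i → f i * g (n ∸ i)) (suc n)))

  ⋆-assoc : ∀ f g h → (f ⋆ g) ⋆ h ≐ f ⋆ (g ⋆ h)
  ⋆-assoc f g h zero    =
    solve 3 (λ a b c → con 0 :+ (con 0 :+ a :* b) :* c := con 0 :+ a :* (con 0 :+ b :* c)) refl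
      (f 0) (g 0) (h 0)
  ⋆-assoc f g h (suc n) = begin
    ((f ⋆ g) ⋆ h) (suc n)
      ≈⟨ ⋆-sucˡ (f ⋆ g) h n ⟩
    (f ⋆ g) 0 * h (suc n) + (((f ⋆ g) ∘ suc) ⋆ h) n
      ≈⟨ +-cong (*-congʳ (⋆-head f g)) (⋆-congʳ h (⋆-sucˡ f g) n) ⟩
    f 0 * g 0 * h (suc n) + ((λ i → f 0 * g (suc i) + ((f ∘ suc) ⋆ g) i) ⋆ h) n
      ≈⟨ +-congˡ (⋆-distribʳ h (λ i → f 0 * g (suc i)) ((f ∘ suc) ⋆ g) n) ⟩
    f 0 * g 0 * h (suc n) + (((λ i → f 0 * g (suc i)) ⋆ h) n + (((f ∘ suc) ⋆ g) ⋆ h) n)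
      ≈⟨ +-congˡ (+-cong (⋆-scaleˡ (f 0) (g ∘ suc) h n) (⋆-assoc (f ∘ suc) g h n)) ⟩
    f 0 * g 0 * h (suc n) + (f 0 * ((g ∘ suc) ⋆ h) n + ((f ∘ suc) ⋆ (g ⋆ h)) n)
      ≈⟨ solve 5 (λ a b c d e → a :* b :* c :+ (a :* d :+ e) := a :* (b :* c :+ d) :+ e) refl
           (f 0) (g 0) (h (suc n)) (((g ∘ suc) ⋆ h) n) (((f ∘ suc) ⋆ (g ⋆ h)) n) ⟩
    f 0 * (g 0 * h (suc n) + ((g ∘ suc) ⋆ h) n) + ((f ∘ suc) ⋆ (g ⋆ h)) n
      ≈⟨ +-congʳ (*-congˡ (⋆-sucˡ g h n)) ⟨
    f 0 * (g ⋆ h) (suc n) + ((f ∘ suc) ⋆ (g ⋆ h)) n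
      ≈⟨ ⋆-sucˡ f (g ⋆ h) n ⟨
    (f ⋆ (g ⋆ h)) (suc n) ∎

  ⋆-zeroˡ : ∀ {f} g → (∀ n → f n ≈ 0#) → ∀ n → (f ⋆ g) n ≈ 0#
  ⋆-zeroˡ g h n = ∑-vanish (suc n) λ i _ → trans (*-congʳ (h i)) (zeroˡ _)

  -- Multiplication by z, when a sequence is read as a power series in z.
  shift : Sequence → Sequence
  shift f zero    = 0#
  shift f (suc n) = f n

  shift-⋆ˡ : ∀ f g → shift f ⋆ g ≐ shift (f ⋆ g)
  shift-⋆ˡ f g zero    = trans (+-identityˡ _) (zeroˡ _)
  shift-⋆ˡ f g (suc n) = trans (⋆-sucˡ (shift f) g n) (trans (+-congʳ (zeroˡ _)) (+-identityˡ _))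

  shift-cong : ∀ {f g} → f ≐ g → shift f ≐ shift g
  shift-cong h zero    = refl
  shift-cong h (suc n) = h n

  shift-⋆ʳ : ∀ f g → f ⋆ shift g ≐ shift (f ⋆ g)
  shift-⋆ʳ f g n = trans (⋆-comm f (shift g) n)
    (trans (shift-⋆ˡ g f n) (shift-cong (⋆-comm g f) n))

-- Inverses in a commutative ring and their recurrences.

module Inverses {c ℓ} (R : CommutativeRing c ℓ) where
  open CommutativeRing R
  open SetoidReasoning setoid
  open SemiringSolver commutativeSemiring

  private
    split : ∀ y x → y ≈ x * y + y * (1# - x)
    split y x = begin
      y                      ≈⟨ *-identityʳ y ⟨
      y * 1#                 ≈⟨ *-congˡ (+-identityʳ 1#) ⟨
      y * (1# + 0#)          ≈⟨ *-congˡ (+-congˡ (-‿inverseʳ x)) ⟨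
      y * (1# + (x - x))     ≈⟨ solve 3 (λ y x z → y :* (con 1 :+ (x :+ z))
                                              := x :* y :+ y :* (con 1 :+ z)) refl y x (- x) ⟩
      x * y + y * (1# - x)   ∎

  inverse-unique : ∀ {v w a} → v * a ≈ 1# → w * a ≈ 1# → v ≈ w
  inverse-unique {v} {w} {a} va wa = begin
    v            ≈⟨ *-identityʳ v ⟨
    v * 1#       ≈⟨ *-congˡ wa ⟨
    v * (w * a)  ≈⟨ solve 3 (λ v w a → v :* (w :* a) := (v :* a) :* w) refl v w a ⟩
    v * a * w    ≈⟨ *-congʳ va ⟩
    1# * w       ≈⟨ *-identityˡ w ⟩
    w            ∎

  -- Both `v` and `v′ * (1# - x)` are inverses of `a`. This turns a reciprocal product into a
  -- recurrence free of division.
  inverse-step : ∀ {v v′ a x} → v * a ≈ 1# → v′ * (a * (1# - x)) ≈ 1# → v′ ≈ x * v′ + v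
  inverse-step {v} {v′} {a} {x} va va′ = trans (split v′ x) (+-congˡ (inverse-unique eq va))
    where
    eq : v′ * (1# - x) * a ≈ 1#
    eq = trans (solve 3 (λ v a y → v :* y :* a := v :* (a :* y)) refl v′ a (1# - x)) va′

  inverse-step⁻¹ : ∀ {v v′ a x} → v * a ≈ 1# → v′ ≈ x * v′ + v → v′ * (a * (1# - x)) ≈ 1#
  inverse-step⁻¹ {v} {v′} {a} {x} va rec = begin
    v′ * (a * (1# - x))  ≈⟨ solve 3 (λ v a y → v :* (a :* y) := v :* y :* a) refl v′ a (1# - x) ⟩
    v′ * (1# - x) * a    ≈⟨ *-congʳ (+-cancelˡ (x * v′) _ _ (trans (sym (split v′ x)) rec)) ⟩
    v * a                ≈⟨ va ⟩
    1#                   ∎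
    where open RingProperties ring using (+-cancelˡ)

-- Functional equations in z and Rogers' identity.

module RogersSums {c ℓ} (R : CommutativeRing c ℓ) where
  open CommutativeRing R
  open Sequences R
  open Inverses R
  open SetoidReasoning setoid
  open SemiringSolver commutativeSemiring

  -- Here q n stands for the n-th power of q, and V n for 1/(q;q)_n.
  module Powers
    (q : ℕ → Carrier) (q-0 : q 0 ≈ 1#) (q-+ : ∀ m n → q (m ℕ.+ n) ≈ q m * q n)
    (V Q : ℕ → Carrier) (V-inverse : ∀ n → V n * Q n ≈ 1#)
    (Q-0 : Q 0 ≈ 1#) (Q-suc : ∀ n → Q (suc n) ≈ Q n * (1# - q (suc n)))
    where
    open ℕSolver.+-*-Solver using () renaming
      (solve to ℕsolve; _:=_ to _:≡_; _:+_ to _⊞_; _:*_ to _⊠_; con to κ)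

    q-cong : ∀ {m n} → m ≡ n → q m ≈ q n
    q-cong eq = reflexive (≡.cong q eq)

    1*1≈1 : ∀ {x y} → x ≈ 1# → y ≈ 1# → x * y ≈ 1#
    1*1≈1 x≈1 y≈1 = trans (*-cong x≈1 y≈1) (*-identityˡ 1#)

    q-0* : ∀ x → q 0 * x ≈ x
    q-0* x = trans (*-congʳ q-0) (*-identityˡ x)

    -- The substitution of qz for z, hence multiplicative for the Cauchy product (`θ-⋆`).
    θ : Sequence → Sequence
    θ f n = q n * f n

    θ-⋆ : ∀ f g → θ (f ⋆ g) ≐ θ f ⋆ θ g
    θ-⋆ f g n = trans (∑-*ˡ (q n) (λ i → f i * g (n ∸ i)) (suc n)) (∑-cong (suc n) term)
      where
      term : ∀ i → i < suc n → q n * (f i * g (n ∸ i)) ≈ θ f i * θ g (n ∸ i)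
      term i (s≤s i≤n) = begin
        q n * (f i * g (n ∸ i))
          ≈⟨ *-congʳ (trans (q-cong (≡.sym (ℕₚ.m+[n∸m]≡n i≤n))) (q-+ i (n ∸ i))) ⟩
        q i * q (n ∸ i) * (f i * g (n ∸ i))
          ≈⟨ solve 4 (λ a b c d → a :* b :* (c :* d) := a :* c :* (b :* d)) refl
               (q i) (q (n ∸ i)) (f i) (g (n ∸ i)) ⟩
        θ f i * θ g (n ∸ i) ∎

    V-0 : V 0 ≈ 1#
    V-0 = inverse-unique (V-inverse 0) (trans (*-identityˡ _) Q-0)

    V-suc : ∀ n → V (suc n) ≈ q (suc n) * V (suc n) + V n
    V-suc n = inverse-step (V-inverse n) (trans (*-congˡ (sym (Q-suc n))) (V-inverse (suc n)))

    -- By Euler, Σ z^n/(q;q)_n = 1/(z;q)_∞; splitting off the factor 1 - z gives V(z) = V(qz) + z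
    -- V(z).
    V-functional : V ≐ (λ n → θ V n + shift V n)
    V-functional zero    = sym (trans (+-identityʳ _) (q-0* _))
    V-functional (suc n) = V-suc n

    V-unique : ∀ W → W 0 ≈ 1# → (∀ n → W (suc n) ≈ q (suc n) * W (suc n) + W n) → W ≐ V
    V-unique W W-0 W-suc n = inverse-unique (inv-W n) (V-inverse n)
      where
      inv-W : ∀ n → W n * Q n ≈ 1#
      inv-W zero    = 1*1≈1 W-0 Q-0
      inv-W (suc n) = trans (*-congˡ (Q-suc n)) (inverse-step⁻¹ (inv-W n) (W-suc n))

    G : Sequence
    G n = q (n ℕ.* n) * V n

    -- The Rogers–Ramanujan equation G(z) = G(zq) + zq G(zq²).
    G-functional : G ≐ (λ n → θ G n + q 1 * shift (θ (θ G)) n)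
    G-functional zero    = sym (trans (+-cong (q-0* _) (zeroʳ _)) (+-identityʳ _))
    G-functional (suc n) = begin
      q ((suc n) ℕ.* (suc n)) * V (suc n)
        ≈⟨ *-congˡ (V-suc n) ⟩
      q ((suc n) ℕ.* (suc n)) * (q (suc n) * V (suc n) + V n)
        ≈⟨ solve 4 (λ a b c d → a :* (b :* c :+ d) := b :* (a :* c) :+ a :* d) refl
             (q ((suc n) ℕ.* (suc n))) (q (suc n)) (V (suc n)) (V n) ⟩
      θ G (suc n) + q ((suc n) ℕ.* (suc n)) * V n
        ≈⟨ +-congˡ (*-congʳ (trans
             (q-cong (ℕsolve 1 (λ n → (κ 1 ⊞ n) ⊠ (κ 1 ⊞ n) :≡ κ 1 ⊞ (n ⊞ (n ⊞ n ⊠ n))) ≡.refl n))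
             (trans (q-+ 1 _) (*-congˡ (trans (q-+ n _) (*-congˡ (q-+ n _))))))) ⟩
      θ G (suc n) + q 1 * (q n * (q n * q (n ℕ.* n))) * V n
        ≈⟨ +-congˡ (solve 4 (λ a b c d → a :* (b :* (b :* c)) :* d := a :* (b :* (b :* (c :* d)))) refl
             (q 1) (q n) (q (n ℕ.* n)) (V n)) ⟩
      θ G (suc n) + q 1 * θ (θ G) n ∎

    A B : Sequence
    A = G ⋆ V
    B = θ G ⋆ V

    G-0 : G 0 ≈ 1#
    G-0 = 1*1≈1 q-0 V-0

    A-0 : A 0 ≈ 1#
    A-0 = trans (⋆-head G V) (1*1≈1 G-0 V-0)

    B-0 : B 0 ≈ 1#
    B-0 = trans (⋆-head (θ G) V) (1*1≈1 (1*1≈1 q-0 G-0) V-0)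

    ⋆V : ∀ f n → (f ⋆ V) n ≈ (f ⋆ θ V) n + shift (f ⋆ V) n
    ⋆V f n = begin
      (f ⋆ V) n                              ≈⟨ ⋆-congˡ f V-functional n ⟩
      (f ⋆ (λ i → θ V i + shift V i)) n      ≈⟨ ⋆-distribˡ f (θ V) (shift V) n ⟩
      (f ⋆ θ V) n + (f ⋆ shift V) n          ≈⟨ +-congˡ (⋆-shiftʳ n) ⟩
      (f ⋆ θ V) n + shift (f ⋆ V) n          ∎
      where ⋆-shiftʳ = shift-⋆ʳ f V

    -- The coefficient of z^{n+1} in B(z) = G(qz)V(qz) + z B(z), whose first term is A(qz).
    B-suc : ∀ n → B (suc n) ≈ B n + q (suc n) * A (suc n)
    B-suc n = trans (⋆V (θ G) (suc n)) (trans (+-congʳ (sym (θ-⋆ G V (suc n)))) (+-comm _ _))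

    A-suc : ∀ n → A (suc n) ≈ A n + (q (suc n) * A (suc n) + q (suc n) * B n)
    A-suc n = trans (⋆V G (suc n)) (trans (+-comm _ _) (+-congˡ (begin
      (G ⋆ θ V) (suc n)
        -- Multiplied by V(qz), the two parts of G(qz) + qz G(q²z) become A(qz) and qz B(qz).
        ≈⟨ ⋆-congʳ (θ V) G-functional (suc n) ⟩
      ((λ i → θ G i + q 1 * shift (θ (θ G)) i) ⋆ θ V) (suc n)
        ≈⟨ ⋆-distribʳ (θ V) (θ G) (λ i → q 1 * shift (θ (θ G)) i) (suc n) ⟩
      (θ G ⋆ θ V) (suc n) + ((λ i → q 1 * shift (θ (θ G)) i) ⋆ θ V) (suc n)
        ≈⟨ +-congˡ (⋆-scaleˡ (q 1) (shift (θ (θ G))) (θ V) (suc n)) ⟩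
      (θ G ⋆ θ V) (suc n) + q 1 * (shift (θ (θ G)) ⋆ θ V) (suc n)
        ≈⟨ +-cong (sym (θ-⋆ G V (suc n))) (*-congˡ
             (trans (shift-⋆ˡ (θ (θ G)) (θ V) (suc n)) (sym (θ-⋆ (θ G) V n)))) ⟩
      q (suc n) * A (suc n) + q 1 * (q n * B n)
        ≈⟨ +-congˡ (trans (sym (*-assoc _ _ _)) (*-congʳ (sym (q-+ 1 n)))) ⟩
      q (suc n) * A (suc n) + q (suc n) * B n ∎)))

    -- I n stands for 1/(q⁴;q⁴)_n, J n for its inverse and P n for (-q²;q²)_n.
    module Limit
      (I J P : ℕ → Carrier) (I-inverse : ∀ n → I n * J n ≈ 1#)
      (J-0 : J 0 ≈ 1#) (J-suc : ∀ n → J (suc n) ≈ J n * (1# - q (4 ℕ.* suc n)))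
      (P-0 : P 0 ≈ 1#) (P-suc : ∀ n → P (suc n) ≈ P n * (1# + q (2 ℕ.* suc n)))
      (N : ℕ) (q-vanish : ∀ n → N < n → q n ≈ 0#)
      where

      -- Equal to 1/(q²;q²)_n, because (q⁴;q⁴)_n = (q²;q²)_n (-q²;q²)_n.
      U : Sequence
      U n = I n * P n

      U-0 : U 0 ≈ 1#
      U-0 = 1*1≈1 (inverse-unique (I-inverse 0) (trans (*-identityˡ _) J-0)) P-0

      U-suc : ∀ n → U (suc n) ≈ q (2 ℕ.* suc n) * U (suc n) + U n
      U-suc n = begin
        i′ * P (suc n)                        ≈⟨ *-congˡ (P-suc n) ⟩
        i′ * (P n * (1# + x))
          ≈⟨ solve 3 (λ i p x → i :* (p :* (con 1 :+ x)) := i :* p :+ x :* i :* p) refl i′ (P n) x ⟩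
        i′ * P n + x * i′ * P n               ≈⟨ +-congʳ (*-congʳ i′-rec) ⟩
        (x * x * i′ + I n) * P n + x * i′ * P n
          ≈⟨ solve 4 (λ i p x j → (x :* x :* i :+ j) :* p :+ x :* i :* p
                := x :* (i :* (p :* (con 1 :+ x))) :+ j :* p) refl i′ (P n) x (I n) ⟩
        x * (i′ * (P n * (1# + x))) + I n * P n ≈⟨ +-congʳ (*-congˡ (*-congˡ (P-suc n))) ⟨
        x * U (suc n) + U n                   ∎
        where
        x = q (2 ℕ.* suc n)
        i′ = I (suc n)
        i′-rec : i′ ≈ x * x * i′ + I n
        i′-rec = trans
          (inverse-step (I-inverse n) (trans (*-congˡ (sym (J-suc n))) (I-inverse (suc n))))
          (+-congʳ (*-congʳ (trans
            (q-cong (ℕsolve 1 (λ m → κ 4 ⊠ m :≡ κ 2 ⊠ m ⊞ κ 2 ⊠ m) ≡.refl (suc n)))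
            (q-+ (2 ℕ.* suc n) (2 ℕ.* suc n)))))

      U-functional : U ≐ (λ n → θ (θ U) n + shift U n)
      U-functional zero    = sym (trans (+-identityʳ _) (trans (q-0* _) (q-0* _)))
      U-functional (suc n) = trans (U-suc n) (+-congʳ (trans
        (*-congʳ (trans (q-cong (≡.cong (suc n ℕ.+_) (ℕₚ.+-identityʳ (suc n)))) (q-+ (suc n) (suc n))))
        (*-assoc _ _ _)))

      -- 1/((z;q²)_∞ (zq;q²)_∞) = 1/(z;q)_∞
      U⋆θU : U ⋆ θ U ≐ V
      U⋆θU = V-unique (U ⋆ θ U)
        (trans (⋆-head U (θ U)) (1*1≈1 U-0 (1*1≈1 q-0 U-0)))
        λ n → begin
          (U ⋆ θ U) (suc n)
            ≈⟨ ⋆-congʳ (θ U) U-functional (suc n) ⟩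
          ((λ i → θ (θ U) i + shift U i) ⋆ θ U) (suc n)
            ≈⟨ ⋆-distribʳ (θ U) (θ (θ U)) (shift U) (suc n) ⟩
          (θ (θ U) ⋆ θ U) (suc n) + (shift U ⋆ θ U) (suc n)
            ≈⟨ +-cong (sym (θ-⋆ (θ U) U (suc n))) (shift-⋆ˡ U (θ U) (suc n)) ⟩
          q (suc n) * (θ U ⋆ U) (suc n) + (U ⋆ θ U) n
            ≈⟨ +-congʳ (*-congˡ (⋆-comm (θ U) U (suc n))) ⟩
          q (suc n) * (U ⋆ θ U) (suc n) + (U ⋆ θ U) n ∎

      -- Euler's formula (-z;q²)_∞ = Σ q^{m(m-1)} z^m/(q²;q²)_m at z = q^{2n+2} has the exponent
      -- m(m-1) + (2n+2)m.
      e : ℕ → ℕ → ℕ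
      e n m = m ℕ.* m ℕ.+ m ℕ.+ 2 ℕ.* (n ℕ.* m)

      -- Euler's expansion of (-q²ⁿ⁺²;q²)_∞, truncated.
      E : Sequence
      E n = ∑ (λ m → q (e n m) * U m) (suc N)

      E-suc : ∀ n → E n ≈ (1# + q (2 ℕ.* suc n)) * E (suc n)
      E-suc n = begin
        E n
          ≈⟨ ∑-cong (suc N) (λ m _ → split m) ⟩
        ∑ (λ m → q (e (suc n) m) * U m + q (e n m) * shift U m) (suc N)
          ≈⟨ ∑-+ (λ m → q (e (suc n) m) * U m) (λ m → q (e n m) * shift U m) (suc N) ⟩
        E (suc n) + ∑ (λ m → q (e n m) * shift U m) (suc N)
          ≈⟨ +-congˡ (∑-head (λ m → q (e n m) * shift U m) N) ⟩
        E (suc n) + (q (e n 0) * 0# + ∑ (λ m → q (e n (suc m)) * U m) N)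
          ≈⟨ +-congˡ (trans (+-congʳ (zeroʳ _)) (+-identityˡ _)) ⟩
        E (suc n) + ∑ (λ m → q (e n (suc m)) * U m) N
          -- Splitting off m = 0 left one term too few for the truncated series; the missing term m
          -- = N has exponent above N and is zero.
          ≈⟨ +-congˡ (trans (+-congˡ last) (+-identityʳ _)) ⟨
        E (suc n) + ∑ (λ m → q (e n (suc m)) * U m) (suc N)
          ≈⟨ +-congˡ (∑-cong (suc N) λ m _ → trans (*-congʳ (e-shift m)) (*-assoc _ _ _)) ⟩
        E (suc n) + ∑ (λ m → q (2 ℕ.* suc n) * (q (e (suc n) m) * U m)) (suc N)
          ≈⟨ +-congˡ (∑-*ˡ (q (2 ℕ.* suc n)) (λ m → q (e (suc n) m) * U m) (suc N)) ⟨
        E (suc n) + q (2 ℕ.* suc n) * E (suc n)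
          ≈⟨ solve 2 (λ a b → a :+ b :* a := (con 1 :+ b) :* a) refl (E (suc n)) (q (2 ℕ.* suc n)) ⟩
        (1# + q (2 ℕ.* suc n)) * E (suc n) ∎
        where
        split : ∀ m → q (e n m) * U m ≈ q (e (suc n) m) * U m + q (e n m) * shift U m
        split m = begin
          q (e n m) * U m
            ≈⟨ *-congˡ (U-functional m) ⟩
          q (e n m) * (q m * (q m * U m) + shift U m)
            ≈⟨ solve 4 (λ a b c d → a :* (b :* (b :* c) :+ d) := a :* (b :* b) :* c :+ a :* d) refl
                 (q (e n m)) (q m) (U m) (shift U m) ⟩
          q (e n m) * (q m * q m) * U m + q (e n m) * shift U m
            ≈⟨ +-congʳ (*-congʳ (trans (q-+ _ _) (*-congˡ (q-+ m m)))) ⟨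
          q (e n m ℕ.+ (m ℕ.+ m)) * U m + q (e n m) * shift U m
            ≈⟨ +-congʳ (*-congʳ (q-cong (ℕsolve 2
                 (λ n m → m ⊠ m ⊞ m ⊞ κ 2 ⊠ (n ⊠ m) ⊞ (m ⊞ m)
                       :≡ m ⊠ m ⊞ m ⊞ κ 2 ⊠ ((κ 1 ⊞ n) ⊠ m)) ≡.refl n m))) ⟩
          q (e (suc n) m) * U m + q (e n m) * shift U m ∎
        e-suc : ∀ m → e n (suc m) ≡ 2 ℕ.* suc n ℕ.+ e (suc n) m
        e-suc m = ℕsolve 2
          (λ n m → (κ 1 ⊞ m) ⊠ (κ 1 ⊞ m) ⊞ (κ 1 ⊞ m) ⊞ κ 2 ⊠ (n ⊠ (κ 1 ⊞ m))
                :≡ κ 2 ⊠ (κ 1 ⊞ n) ⊞ (m ⊠ m ⊞ m ⊞ κ 2 ⊠ ((κ 1 ⊞ n) ⊠ m))) ≡.refl n m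
        e-shift : ∀ m → q (e n (suc m)) ≈ q (2 ℕ.* suc n) * q (e (suc n) m)
        e-shift m = trans (q-cong (e-suc m)) (q-+ _ _)
        last : q (e n (suc N)) * U N ≈ 0#
        last = trans (*-congʳ (q-vanish _
          (ℕₚ.≤-trans (ℕₚ.m≤n+m (suc N) (suc N ℕ.* suc N)) (ℕₚ.m≤m+n _ _)))) (zeroˡ _)

      -- All factors of (-q^{2N+2};q²)_∞ are 1 modulo q^{N+1}. In the expansion, each term with m ≥
      -- 1 has exponent at least 2N + 2.
      E-limit : E N ≈ 1#
      E-limit = begin
        E N
          ≈⟨ ∑-head (λ m → q (e N m) * U m) N ⟩
        q (e N 0) * U 0 + ∑ (λ m → q (e N (suc m)) * U (suc m)) N
          ≈⟨ +-cong (*-cong (trans (q-cong (≡.cong (2 ℕ.*_) (ℕₚ.*-zeroʳ N))) q-0) U-0)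
               (∑-vanish N λ m _ → trans (*-congʳ (q-vanish _ (N<e m))) (zeroˡ _)) ⟩
        1# * 1# + 0#
          ≈⟨ trans (+-identityʳ _) (*-identityˡ 1#) ⟩
        1# ∎
        where
        N<e : ∀ m → N < e N (suc m)
        N<e m = ℕₚ.+-mono-≤ {1} {suc m ℕ.* suc m ℕ.+ suc m} {N} (s≤s z≤n)
          (ℕₚ.≤-trans (ℕₚ.m≤m*n N (suc m)) (ℕₚ.m≤n*m (N ℕ.* suc m) 2))

      P*E : ∀ n → P n * E n ≈ P 0 * E 0
      P*E zero    = refl
      P*E (suc n) = begin
        P (suc n) * E (suc n)                           ≈⟨ *-congʳ (P-suc n) ⟩
        P n * (1# + q (2 ℕ.* suc n)) * E (suc n)        ≈⟨ *-assoc _ _ _ ⟩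
        P n * ((1# + q (2 ℕ.* suc n)) * E (suc n))      ≈⟨ *-congˡ (E-suc n) ⟨
        P n * E n                                       ≈⟨ P*E n ⟩
        P 0 * E 0                                       ∎

      -- `P N` stands for (-q²;q²)_∞, which splits into its first n factors and the tail `E n`. The
      -- product of head and tail does not depend on n, and at n = N the tail is 1.
      P-limit : ∀ n → P N ≈ P n * E n
      P-limit n = begin
        P N          ≈⟨ *-identityʳ _ ⟨
        P N * 1#     ≈⟨ *-congˡ E-limit ⟨
        P N * E N    ≈⟨ P*E N ⟩
        P 0 * E 0    ≈⟨ P*E n ⟨
        P n * E n    ∎

      square-≥ : ∀ n → n ≤ n ℕ.* n
      square-≥ zero    = z≤n
      square-≥ (suc n) = ℕₚ.m≤m*n (suc n) (suc n)

      rogers : ∑ (λ n → q (n ℕ.* n) * I n) (suc N) * P N ≈ ∑ G (suc N)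
      rogers = begin
        ∑ (λ n → q (n ℕ.* n) * I n) (suc N) * P N
          ≈⟨ ∑-*ʳ (P N) (λ n → q (n ℕ.* n) * I n) (suc N) ⟩
        ∑ (λ n → q (n ℕ.* n) * I n * P N) (suc N)
          ≈⟨ ∑-cong (suc N) (λ n _ → expand n) ⟩
        ∑ (λ n → ∑ (t n) (suc N)) (suc N)
          -- Terms with n + m > N carry q^{(n+m)²} and vanish, so the square of indices may be
          -- summed along diagonals.
          ≈⟨ ∑-triangle t (suc N) ℕₚ.≤-refl t-vanish ⟨
        ∑ (λ n → ∑ (λ i → t i (n ∸ i)) (suc n)) (suc N)
          ≈⟨ ∑-cong (suc N) (λ n _ → collect n) ⟩
        ∑ G (suc N) ∎
        where
        t : ℕ → ℕ → Carrier
        t n m = q ((n ℕ.+ m) ℕ.* (n ℕ.+ m)) * (U n * θ U m)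

        expand : ∀ n → q (n ℕ.* n) * I n * P N ≈ ∑ (t n) (suc N)
        expand n = begin
          q (n ℕ.* n) * I n * P N
            ≈⟨ *-congˡ (P-limit n) ⟩
          q (n ℕ.* n) * I n * (P n * E n)
            ≈⟨ solve 4 (λ a b c d → a :* b :* (c :* d) := a :* (b :* c) :* d) refl
                 (q (n ℕ.* n)) (I n) (P n) (E n) ⟩
          q (n ℕ.* n) * U n * E n
            ≈⟨ ∑-*ˡ _ (λ m → q (e n m) * U m) (suc N) ⟩
          ∑ (λ m → q (n ℕ.* n) * U n * (q (e n m) * U m)) (suc N)
            ≈⟨ ∑-cong (suc N) (λ m _ → term m) ⟩
          ∑ (t n) (suc N) ∎
          where
          term : ∀ m → q (n ℕ.* n) * U n * (q (e n m) * U m) ≈ t n m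
          term m = begin
            q (n ℕ.* n) * U n * (q (e n m) * U m)
              ≈⟨ solve 4 (λ a b c d → a :* b :* (c :* d) := a :* c :* (b :* d)) refl
                   (q (n ℕ.* n)) (U n) (q (e n m)) (U m) ⟩
            q (n ℕ.* n) * q (e n m) * (U n * U m)
              -- The exponents n² and `e n m` add up to (n+m)² + m: the square is constant on a
              -- diagonal, and q^m is what turns `U m` into `θ U m`.
              ≈⟨ *-congʳ (trans (sym (q-+ _ _)) (trans (q-cong (ℕsolve 2
                   (λ n m → n ⊠ n ⊞ (m ⊠ m ⊞ m ⊞ κ 2 ⊠ (n ⊠ m)) :≡ (n ⊞ m) ⊠ (n ⊞ m) ⊞ m) ≡.refl n m))
                   (q-+ _ m))) ⟩
            q ((n ℕ.+ m) ℕ.* (n ℕ.+ m)) * q m * (U n * U m)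
              ≈⟨ solve 4 (λ a b c d → a :* b :* (c :* d) := a :* (c :* (b :* d))) refl
                   (q ((n ℕ.+ m) ℕ.* (n ℕ.+ m))) (q m) (U n) (U m) ⟩
            t n m ∎

        t-vanish : ∀ i j → suc N ≤ i ℕ.+ j → t i j ≈ 0#
        t-vanish i j N< = trans (*-congʳ (q-vanish _ (ℕₚ.≤-trans N< (square-≥ (i ℕ.+ j))))) (zeroˡ _)

        collect : ∀ n → ∑ (λ i → t i (n ∸ i)) (suc n) ≈ G n
        collect n = begin
          ∑ (λ i → t i (n ∸ i)) (suc n)
            ≈⟨ ∑-cong (suc n) (λ { i (s≤s i≤n) →
                 *-congʳ (q-cong (≡.cong (λ k → k ℕ.* k) (ℕₚ.m+[n∸m]≡n i≤n))) }) ⟩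
          ∑ (λ i → q (n ℕ.* n) * (U i * θ U (n ∸ i))) (suc n)
            ≈⟨ ∑-*ˡ (q (n ℕ.* n)) (λ i → U i * θ U (n ∸ i)) (suc n) ⟨
          q (n ℕ.* n) * (U ⋆ θ U) n
            ≈⟨ *-congˡ (U⋆θU n) ⟩
          G n ∎

      -- Passing from `V j` to a later `V (d + j)` changes only coefficients from q^{j+1} on, and
      -- the factor `q a` pushes these beyond q^N.
      q*V-stable : ∀ a j d → N < a ℕ.+ suc j → q a * V (d ℕ.+ j) ≈ q a * V j
      q*V-stable a j zero    h = refl
      q*V-stable a j (suc d) h = begin
        q a * V (suc d ℕ.+ j)
          ≈⟨ *-congˡ (V-suc (d ℕ.+ j)) ⟩
        q a * (q (suc d ℕ.+ j) * V (suc d ℕ.+ j) + V (d ℕ.+ j))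
          ≈⟨ solve 4 (λ a b c d → a :* (b :* c :+ d) := a :* b :* c :+ a :* d) refl
               (q a) (q (suc d ℕ.+ j)) (V (suc d ℕ.+ j)) (V (d ℕ.+ j)) ⟩
        q a * q (suc d ℕ.+ j) * V (suc d ℕ.+ j) + q a * V (d ℕ.+ j)
          ≈⟨ +-congʳ (*-congʳ (trans (sym (q-+ a _)) (q-vanish _
               (ℕₚ.<-≤-trans h (ℕₚ.+-monoʳ-≤ a (s≤s (ℕₚ.m≤n+m j d))))))) ⟩
        0# * V (suc d ℕ.+ j) + q a * V (d ℕ.+ j)
          ≈⟨ trans (+-congʳ (zeroˡ _)) (+-identityˡ _) ⟩
        q a * V (d ℕ.+ j)
          ≈⟨ q*V-stable a j d h ⟩
        q a * V j ∎

      -- `V N` stands for 1/(q;q)_∞, whereas `A N` contains `V (N ∸ n)`. The factor q^{n²} of `G n`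
      -- hides the difference, since n² + (N - n) + 1 > N by n ≤ n².
      A-limit : ∑ (λ n → q (n ℕ.* n) * I n) (suc N) * P N * V N ≈ A N
      A-limit = begin
        ∑ (λ n → q (n ℕ.* n) * I n) (suc N) * P N * V N  ≈⟨ *-congʳ rogers ⟩
        ∑ G (suc N) * V N                                ≈⟨ ∑-*ʳ (V N) G (suc N) ⟩
        ∑ (λ n → G n * V N) (suc N)                      ≈⟨ ∑-cong (suc N) (λ { n (s≤s n≤N) → term n n≤N }) ⟩
        A N                                              ∎
        where
        term : ∀ n → n ≤ N → G n * V N ≈ G n * V (N ∸ n)
        term n n≤N = begin
          q (n ℕ.* n) * V n * V N
            ≈⟨ solve 3 (λ a b c → a :* b :* c := b :* (a :* c)) refl (q (n ℕ.* n)) (V n) (V N) ⟩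
          V n * (q (n ℕ.* n) * V N)
            ≈⟨ *-congˡ (*-congˡ (reflexive (≡.cong V (≡.sym (ℕₚ.m+[n∸m]≡n n≤N))))) ⟩
          V n * (q (n ℕ.* n) * V (n ℕ.+ (N ∸ n)))
            ≈⟨ *-congˡ (q*V-stable (n ℕ.* n) (N ∸ n) n N<) ⟩
          V n * (q (n ℕ.* n) * V (N ∸ n))
            ≈⟨ solve 3 (λ a b c → a :* b :* c := b :* (a :* c)) refl (q (n ℕ.* n)) (V n) (V (N ∸ n)) ⟨
          G n * V (N ∸ n) ∎
          where
          N< : N < n ℕ.* n ℕ.+ suc (N ∸ n)
          N< = ℕₚ.≤-trans
            (ℕₚ.≤-reflexive (≡.trans (≡.cong suc (≡.sym (ℕₚ.m+[n∸m]≡n n≤N))) (≡.sym (ℕₚ.+-suc n (N ∸ n)))))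
            (ℕₚ.+-monoˡ-≤ (suc (N ∸ n)) (square-≥ n))

-- Integer power series in q and their truncations.

module ℤ-Seq = Sequences ℤₚ.+-*-commutativeRing
open ℤ-Seq using (_⋆_)

sumTo≡∑ : ∀ f n → sumTo f n ≡ ℤ-Seq.∑ f n
sumTo≡∑ f zero    = ≡.refl
sumTo≡∑ f (suc n) = ≡.cong (ℤ._+ f n) (sumTo≡∑ f n)

⊛≡⋆ : ∀ f g n → (f ⊛ g) n ≡ (f ⋆ g) n
⊛≡⋆ f g n = sumTo≡∑ (λ i → f i ℤ.* g (n ∸ i)) (suc n)

sumTo-cong : ∀ {f g} n → (∀ i → f i ≡ g i) → sumTo f n ≡ sumTo g n
sumTo-cong zero    h = ≡.refl
sumTo-cong (suc n) h = ≡.cong₂ ℤ._+_ (sumTo-cong n h) (h n)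

⊛-cong-≤ : ∀ {f f′ g g′} n → (∀ i → i ≤ n → f i ≡ f′ i) → (∀ i → i ≤ n → g i ≡ g′ i) →
  (f ⊛ g) n ≡ (f′ ⊛ g′) n
⊛-cong-≤ {f} {f′} {g} {g′} n hf hg = begin
  (f ⊛ g) n    ≡⟨ ⊛≡⋆ f g n ⟩
  (f ⋆ g) n    ≡⟨ ℤ-Seq.⋆-cong-≤ n hf hg ⟩
  (f′ ⋆ g′) n  ≡⟨ ⊛≡⋆ f′ g′ n ⟨
  (f′ ⊛ g′) n  ∎
  where open ≡.≡-Reasoning

⊛-sucˡ : ∀ f g n → (f ⊛ g) (suc n) ≡ f 0 ℤ.* g (suc n) ℤ.+ ((f ∘ suc) ⊛ g) n
⊛-sucˡ f g n = begin
  (f ⊛ g) (suc n)                                    ≡⟨ ⊛≡⋆ f g (suc n) ⟩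
  (f ⋆ g) (suc n)                                    ≡⟨ ℤ-Seq.⋆-sucˡ f g n ⟩
  f 0 ℤ.* g (suc n) ℤ.+ ((f ∘ suc) ⋆ g) n
    ≡⟨ ≡.cong (ℤ._+_ (f 0 ℤ.* g (suc n))) (⊛≡⋆ (f ∘ suc) g n) ⟨
  f 0 ℤ.* g (suc n) ℤ.+ ((f ∘ suc) ⊛ g) n            ∎
  where open ≡.≡-Reasoning

⊛-comm : ∀ f g n → (f ⊛ g) n ≡ (g ⊛ f) n
⊛-comm f g n = begin
  (f ⊛ g) n  ≡⟨ ⊛≡⋆ f g n ⟩
  (f ⋆ g) n  ≡⟨ ℤ-Seq.⋆-comm f g n ⟩
  (g ⋆ f) n  ≡⟨ ⊛≡⋆ g f n ⟨
  (g ⊛ f) n  ∎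
  where open ≡.≡-Reasoning

⊛-assoc : ∀ f g h n → ((f ⊛ g) ⊛ h) n ≡ (f ⊛ (g ⊛ h)) n
⊛-assoc f g h n = begin
  ((f ⊛ g) ⊛ h) n  ≡⟨ ⊛≡⋆ (f ⊛ g) h n ⟩
  ((f ⊛ g) ⋆ h) n  ≡⟨ ℤ-Seq.⋆-congʳ h (⊛≡⋆ f g) n ⟩
  ((f ⋆ g) ⋆ h) n  ≡⟨ ℤ-Seq.⋆-assoc f g h n ⟩
  (f ⋆ (g ⋆ h)) n  ≡⟨ ℤ-Seq.⋆-congˡ f (⊛≡⋆ g h) n ⟨
  (f ⋆ (g ⊛ h)) n  ≡⟨ ⊛≡⋆ f (g ⊛ h) n ⟨
  (f ⊛ (g ⊛ h)) n  ∎
  where open ≡.≡-Reasoning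

⊛-distribʳ : ∀ h f g n → ((f ⊕ g) ⊛ h) n ≡ ((f ⊛ h) ⊕ (g ⊛ h)) n
⊛-distribʳ h f g n = begin
  ((f ⊕ g) ⊛ h) n          ≡⟨ ⊛≡⋆ (f ⊕ g) h n ⟩
  ((f ⊕ g) ⋆ h) n          ≡⟨ ℤ-Seq.⋆-distribʳ h f g n ⟩
  (f ⋆ h) n ℤ.+ (g ⋆ h) n  ≡⟨ ≡.cong₂ ℤ._+_ (⊛≡⋆ f h n) (⊛≡⋆ g h n) ⟨
  ((f ⊛ h) ⊕ (g ⊛ h)) n    ∎
  where open ≡.≡-Reasoning

0⊛ : ∀ f n → ((λ _ → + 0) ⊛ f) n ≡ + 0
0⊛ f n = ≡.trans (⊛≡⋆ (λ _ → + 0) f n) (ℤ-Seq.⋆-zeroˡ f (λ _ → ≡.refl) n)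

⊛-identityˡ : ∀ f n → (one ⊛ f) n ≡ f n
⊛-identityˡ f zero    = ≡.trans (ℤₚ.+-identityˡ _) (ℤₚ.*-identityˡ _)
⊛-identityˡ f (suc n) = begin
  (one ⊛ f) (suc n)                                  ≡⟨ ⊛-sucˡ one f n ⟩
  + 1 ℤ.* f (suc n) ℤ.+ ((λ _ → + 0) ⊛ f) n
    ≡⟨ ≡.cong₂ ℤ._+_ (ℤₚ.*-identityˡ (f (suc n))) (0⊛ f n) ⟩
  f (suc n) ℤ.+ + 0                                  ≡⟨ ℤₚ.+-identityʳ _ ⟩
  f (suc n)                                          ∎
  where open ≡.≡-Reasoning

-- ℤ[[q]]/(q^K)
Truncated : ℕ → CommutativeRing 0ℓ 0ℓ
Truncated K = record
  { Carrier = Series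
  ; _≈_ = λ f g → ∀ n → n < K → f n ≡ g n
  ; _+_ = _⊕_
  ; _*_ = _⊛_
  ; -_ = neg
  ; 0# = λ _ → + 0
  ; 1# = one
  ; isCommutativeRing = record
    { isRing = record
      { +-isAbelianGroup = record
        { isGroup = record
          { isMonoid = record
            { isSemigroup = record
              { isMagma = record
                { isEquivalence = record
                  { refl = λ _ _ → ≡.refl
                  ; sym = λ h n n<K → ≡.sym (h n n<K)
                  ; trans = λ h h′ n n<K → ≡.trans (h n n<K) (h′ n n<K)
                  }
                ; ∙-cong = λ h h′ n n<K → ≡.cong₂ ℤ._+_ (h n n<K) (h′ n n<K)
                }
              ; assoc = λ f g h n _ → ℤₚ.+-assoc (f n) (g n) (h n)
              }
            ; identity = (λ f n _ → ℤₚ.+-identityˡ (f n)) , (λ f n _ → ℤₚ.+-identityʳ (f n))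
            }
          ; inverse = (λ f n _ → ℤₚ.+-inverseˡ (f n)) , (λ f n _ → ℤₚ.+-inverseʳ (f n))
          ; ⁻¹-cong = λ h n n<K → ≡.cong ℤ.-_ (h n n<K)
          }
        ; comm = λ f g n _ → ℤₚ.+-comm (f n) (g n)
        }
      ; *-cong = λ h h′ n n<K → ⊛-cong-≤ n
          (λ i i≤n → h i (ℕₚ.≤-<-trans i≤n n<K)) (λ i i≤n → h′ i (ℕₚ.≤-<-trans i≤n n<K))
      ; *-assoc = λ f g h n _ → ⊛-assoc f g h n
      ; *-identity = (λ f n _ → ⊛-identityˡ f n)
                   , (λ f n _ → ≡.trans (⊛-comm f one n) (⊛-identityˡ f n))
      ; distrib = (λ f g h n _ → ≡.trans (⊛-comm f (g ⊕ h) n) (≡.trans (⊛-distribʳ f g h n)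
                    (≡.cong₂ ℤ._+_ (⊛-comm g f n) (⊛-comm h f n))))
                , (λ f g h n _ → ⊛-distribʳ f g h n)
      }
    ; *-comm = λ f g n _ → ⊛-comm f g n
    }
  }

-- Monomials, inverses and Pochhammer products as series.

∑-coefficient : ∀ K F n k → Sequences.∑ (Truncated K) F n k ≡ sumTo (λ i → F i k) n
∑-coefficient K F zero    k = ≡.refl
∑-coefficient K F (suc n) k = ≡.cong (ℤ._+ F n k) (∑-coefficient K F n k)

mono-suc-⊛ : ∀ k f n → (mono (suc k) ⊛ f) (suc n) ≡ (mono k ⊛ f) n
mono-suc-⊛ k f n = ≡.trans (⊛-sucˡ (mono (suc k)) f n)
  (≡.trans (≡.cong (ℤ._+ (mono k ⊛ f) n) (ℤₚ.*-zeroˡ (f (suc n)))) (ℤₚ.+-identityˡ _))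

mono-0 : ∀ n → mono 0 n ≡ one n
mono-0 zero    = ≡.refl
mono-0 (suc n) = ≡.refl

mono-⊛-+ : ∀ k f n → (mono k ⊛ f) (k ℕ.+ n) ≡ f n
mono-⊛-+ zero    f n = ≡.trans
  (⊛-cong-≤ {g = f} n (λ i _ → mono-0 i) (λ _ _ → ≡.refl)) (⊛-identityˡ f n)
mono-⊛-+ (suc k) f n = ≡.trans (mono-suc-⊛ k f (k ℕ.+ n)) (mono-⊛-+ k f n)

mono-⊛-< : ∀ {k} f {n} → n < k → (mono k ⊛ f) n ≡ + 0
mono-⊛-< {suc k} f {zero}  _         = ≡.trans (ℤₚ.+-identityˡ _) (ℤₚ.*-zeroˡ (f 0))
mono-⊛-< {suc k} f {suc n} (s≤s n<k) = ≡.trans (mono-suc-⊛ k f n) (mono-⊛-< f n<k)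

mono-< : ∀ {k n} → n < k → mono k n ≡ + 0
mono-< {suc k} {zero}  _         = ≡.refl
mono-< {suc k} {suc n} (s≤s n<k) = mono-< n<k

mono-+ : ∀ j k n → mono (j ℕ.+ k) n ≡ (mono j ⊛ mono k) n
mono-+ zero    k n       = ≡.sym (mono-⊛-+ 0 (mono k) n)
mono-+ (suc j) k zero    = ≡.sym (mono-⊛-< {suc j} (mono k) (s≤s z≤n))
mono-+ (suc j) k (suc n) = ≡.trans (mono-+ j k n) (≡.sym (mono-suc-⊛ j (mono k) n))

at-++ˡ : ∀ xs ys {k} → k < length xs → at (xs List.++ ys) k ≡ at xs k
at-++ˡ (x List.∷ xs) ys {zero}  _         = ≡.refl
at-++ˡ (x List.∷ xs) ys {suc k} (s≤s k<n) = at-++ˡ xs ys k<n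

at-++-length : ∀ xs y → at (xs List.++ List.[ y ]) (length xs) ≡ y
at-++-length List.[]       y = ≡.refl
at-++-length (x List.∷ xs) y = at-++-length xs y

module _ (a : Series) where

  length-invUpTo : ∀ m → length (invUpTo a m) ≡ suc m
  length-invUpTo zero    = ≡.refl
  length-invUpTo (suc m) = ≡.trans (Listₚ.length-++ (invUpTo a m))
    (≡.trans (ℕₚ.+-comm _ 1) (≡.cong suc (length-invUpTo m)))

  -- Each list of coefficients is a prefix of the next, so entry k is settled once it has been
  -- appended. Hence the defining recursion of `inv` becomes a convolution in `inv-suc`.
  at-invUpTo : ∀ {k} m → k ≤ m → at (invUpTo a m) k ≡ inv a k
  at-invUpTo m k≤m with ℕₚ.m≤n⇒m<n∨m≡n k≤m
  ... | inj₂ ≡.refl = ≡.refl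
  at-invUpTo (suc m) _ | inj₁ (s≤s k≤m) = ≡.trans
    (at-++ˡ (invUpTo a m) _ (ℕₚ.≤-trans (s≤s k≤m) (ℕₚ.≤-reflexive (≡.sym (length-invUpTo m)))))
    (at-invUpTo m k≤m)

  inv-suc : ∀ m → inv a (suc m) ≡ ℤ.- ((a ∘ suc) ⊛ inv a) m
  inv-suc m = ≡.trans
    (≡.subst (λ k → at (invUpTo a m List.++ List.[ y ]) k ≡ y) (length-invUpTo m)
      (at-++-length (invUpTo a m) y))
    (≡.cong ℤ.-_ (sumTo-cong (suc m) λ i →
      ≡.cong (a (suc i) ℤ.*_) (at-invUpTo m (ℕₚ.m∸n≤m m i))))
    where y = ℤ.- sumTo (λ i → a (suc i) ℤ.* at (invUpTo a m) (m ∸ i)) (suc m)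

  inv-⊛ : a 0 ≡ + 1 → ∀ n → (inv a ⊛ a) n ≡ one n
  inv-⊛ a-0 zero    = ≡.cong (λ x → + 0 ℤ.+ + 1 ℤ.* x) a-0
  inv-⊛ a-0 (suc n) = begin
    (inv a ⊛ a) (suc n)                                  ≡⟨ ⊛-comm (inv a) a (suc n) ⟩
    (a ⊛ inv a) (suc n)                                  ≡⟨ ⊛-sucˡ a (inv a) n ⟩
    a 0 ℤ.* inv a (suc n) ℤ.+ ((a ∘ suc) ⊛ inv a) n
      ≡⟨ ≡.cong (λ x → x ℤ.* inv a (suc n) ℤ.+ ((a ∘ suc) ⊛ inv a) n) a-0 ⟩
    + 1 ℤ.* inv a (suc n) ℤ.+ ((a ∘ suc) ⊛ inv a) n
      ≡⟨ ≡.cong (ℤ._+ ((a ∘ suc) ⊛ inv a) n)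
           (≡.trans (ℤₚ.*-identityˡ (inv a (suc n))) (inv-suc n)) ⟩
    ℤ.- ((a ∘ suc) ⊛ inv a) n ℤ.+ ((a ∘ suc) ⊛ inv a) n  ≡⟨ ℤₚ.+-inverseˡ (((a ∘ suc) ⊛ inv a) n) ⟩
    + 0                                                  ∎
    where open ≡.≡-Reasoning

spow-mono : ∀ k n j → spow (mono k) n j ≡ mono (k ℕ.* n) j
spow-mono k zero    j = ≡.trans (≡.sym (mono-0 j)) (≡.cong (λ e → mono e j) (≡.sym (ℕₚ.*-zeroʳ k)))
spow-mono k (suc n) j = begin
  (spow (mono k) n ⊛ mono k) j
    ≡⟨ ⊛-cong-≤ {g = mono k} j (λ i _ → spow-mono k n i) (λ _ _ → ≡.refl) ⟩
  (mono (k ℕ.* n) ⊛ mono k) j      ≡⟨ mono-+ (k ℕ.* n) k j ⟨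
  mono (k ℕ.* n ℕ.+ k) j
    ≡⟨ ≡.cong (λ e → mono e j) (≡.trans (ℕₚ.+-comm _ k) (≡.sym (ℕₚ.*-suc k n))) ⟩
  mono (k ℕ.* suc n) j             ∎
  where open ≡.≡-Reasoning

mono-⊛-spow : ∀ k n j → (mono k ⊛ spow (mono k) n) j ≡ mono (k ℕ.* suc n) j
mono-⊛-spow k n j = ≡.trans (⊛-comm (mono k) (spow (mono k) n) j) (spow-mono k (suc n) j)

neg-⊛ : ∀ f g n → (neg f ⊛ g) n ≡ neg (f ⊛ g) n
neg-⊛ f g n = ≡.sym (-‿distribˡ-* f g n (ℕₚ.n<1+n n))
  where open RingProperties (CommutativeRing.ring (Truncated (suc n))) using (-‿distribˡ-*)

poch-constant : ∀ a b n → a 0 ≡ + 0 → poch a b n 0 ≡ + 1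
poch-constant a b zero    a-0 = ≡.refl
poch-constant a b (suc n) a-0 = ≡.cong₂ (λ x y → + 0 ℤ.+ x ℤ.* (+ 1 ℤ.+ ℤ.- (+ 0 ℤ.+ y ℤ.* spow b n 0)))
  (poch-constant a b n a-0) a-0

-- By `small` every factor from index k on is 1 + O(q^{k+1}) and cannot affect coefficient k.
poch-stable : ∀ a b k → (∀ n j → j ≤ n → (a ⊛ spow b n) j ≡ + 0) →
  ∀ d → poch a b (d ℕ.+ k) k ≡ poch a b k k
poch-stable a b k small zero    = ≡.refl
poch-stable a b k small (suc d) = begin
  (poch a b (d ℕ.+ k) ⊛ (one ⊕ neg (a ⊛ spow b (d ℕ.+ k)))) k
    ≡⟨ ⊛-cong-≤ {poch a b (d ℕ.+ k)} k (λ _ _ → ≡.refl) (λ i i≤k →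
         ≡.trans (≡.cong (λ x → one i ℤ.+ ℤ.- x) (small _ i (ℕₚ.≤-trans i≤k (ℕₚ.m≤n+m k d))))
           (ℤₚ.+-identityʳ (one i))) ⟩
  (poch a b (d ℕ.+ k) ⊛ one) k
    ≡⟨ ≡.trans (⊛-comm (poch a b (d ℕ.+ k)) one k) (⊛-identityˡ (poch a b (d ℕ.+ k)) k) ⟩
  poch a b (d ℕ.+ k) k
    ≡⟨ poch-stable a b k small d ⟩
  poch a b k k ∎
  where open ≡.≡-Reasoning

pochInf≡poch : ∀ a b → (∀ n j → j ≤ n → (a ⊛ spow b n) j ≡ + 0) →
  ∀ {k N} → k ≤ N → pochInf a b k ≡ poch a b N k
-- `pochInf` takes k + 1 factors for coefficient k; the case d = 1 removes the extra one before
-- comparing with N factors.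
pochInf≡poch a b small {k} {N} k≤N = ≡.trans (poch-stable a b k small 1)
  (≡.trans (≡.sym (poch-stable a b k small (N ∸ k)))
    (≡.cong (λ n → poch a b n k) (ℕₚ.m∸n+n≡m k≤N)))

mono-spow-small : ∀ k → 1 ≤ k → ∀ n j → j ≤ n → (mono k ⊛ spow (mono k) n) j ≡ + 0
mono-spow-small k 1≤k n j j≤n = ≡.trans (mono-⊛-spow k n j)
  (mono-< (ℕₚ.≤-trans (s≤s j≤n) (ℕₚ.m≤n*m (suc n) k ⦃ ℕ.>-nonZero 1≤k ⦄)))

neg-mono-spow-small : ∀ k → 1 ≤ k → ∀ n j → j ≤ n → (neg (mono k) ⊛ spow (mono k) n) j ≡ + 0
neg-mono-spow-small k 1≤k n j j≤n =
  ≡.trans (neg-⊛ (mono k) (spow (mono k) n) j) (≡.cong ℤ.-_ (mono-spow-small k 1≤k n j j≤n))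

-- The series of the theorem and their recurrences.

Q V J I P G : ℕ → Series
Q = poch (mono 1) (mono 1)
V = inv ∘ Q
J = poch (mono 4) (mono 4)
I = inv ∘ J
P = poch (neg (mono 2)) (mono 2)
G n = mono (n ℕ.* n) ⊛ V n

-- Generating functions of the cylindric partitions with profile (2,1), respectively (3,0),
-- and parts at most M.
A B : ℕ → Series
A M k = sumTo (λ i → (G i ⊛ V (M ∸ i)) k) (suc M)
B M k = sumTo (λ i → (mono i ⊛ G i ⊛ V (M ∸ i)) k) (suc M)

poch-suc : ∀ k n j → poch (mono k) (mono k) (suc n) j ≡
  (poch (mono k) (mono k) n ⊛ (one ⊕ neg (mono (k ℕ.* suc n)))) j
poch-suc k n j = ⊛-cong-≤ {poch (mono k) (mono k) n} j (λ _ _ → ≡.refl)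
  λ i _ → ≡.cong (λ x → one i ℤ.+ ℤ.- x) (mono-⊛-spow k n i)

poch-neg-suc : ∀ k n j → poch (neg (mono k)) (mono k) (suc n) j ≡
  (poch (neg (mono k)) (mono k) n ⊛ (one ⊕ mono (k ℕ.* suc n))) j
poch-neg-suc k n j = ⊛-cong-≤ {poch (neg (mono k)) (mono k) n} j (λ _ _ → ≡.refl)
  λ i _ → ≡.cong (ℤ._+_ (one i)) (≡.trans (≡.cong ℤ.-_ (neg-⊛ (mono k) (spow (mono k) n) i))
    (≡.trans (ℤₚ.neg-involutive _) (mono-⊛-spow k n i)))

V-inverse : ∀ n k → (V n ⊛ Q n) k ≡ one k
V-inverse n = inv-⊛ (Q n) (poch-constant (mono 1) (mono 1) n ≡.refl)

I-inverse : ∀ n k → (I n ⊛ J n) k ≡ one k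
I-inverse n = inv-⊛ (J n) (poch-constant (mono 4) (mono 4) n ≡.refl)

-- The quotient ring changes with the coefficient N under study, but `A` and `B` must not, since the
-- counting argument compares different N. `A≡` and `B≡` connect the sums taken in the ring with the
-- coefficientwise ones.
module Rogers (N : ℕ) where
  module Sums = RogersSums.Powers (Truncated (suc N))
    mono (λ n _ → mono-0 n) (λ j k n _ → mono-+ j k n)
    V Q (λ n k _ → V-inverse n k) (λ _ _ → ≡.refl)
    (λ n k _ → ≡.trans (poch-suc 1 n k)
      (≡.cong (λ e → (Q n ⊛ (one ⊕ neg (mono e))) k) (ℕₚ.*-identityˡ (suc n))))
  module Limit = Sums.Limit I J P (λ n k _ → I-inverse n k) (λ _ _ → ≡.refl) (λ n k _ → poch-suc 4 n k)
    (λ _ _ → ≡.refl) (λ n k _ → poch-neg-suc 2 n k) N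
    (λ n N<n k k<1+N → mono-< (ℕₚ.<-≤-trans k<1+N N<n))

  A≡ : ∀ M k → Sums.A M k ≡ A M k
  A≡ M k = ∑-coefficient (suc N) (λ i → G i ⊛ V (M ∸ i)) (suc M) k

  B≡ : ∀ M k → Sums.B M k ≡ B M k
  B≡ M k = ∑-coefficient (suc N) (λ i → mono i ⊛ G i ⊛ V (M ∸ i)) (suc M) k

  mono-⊛-A≡ : ∀ e M k → (mono e ⊛ Sums.A M) k ≡ (mono e ⊛ A M) k
  mono-⊛-A≡ e M k = ⊛-cong-≤ {mono e} k (λ _ _ → ≡.refl) (λ i _ → A≡ M i)

  mono-⊛-B≡ : ∀ e M k → (mono e ⊛ Sums.B M) k ≡ (mono e ⊛ B M) k
  mono-⊛-B≡ e M k = ⊛-cong-≤ {mono e} k (λ _ _ → ≡.refl) (λ i _ → B≡ M i)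

A-zero : ∀ N → A 0 N ≡ one N
A-zero N = ≡.trans (≡.sym (A≡ 0 N)) (Sums.A-0 N (ℕₚ.n<1+n N))
  where open Rogers N

B-zero : ∀ N → B 0 N ≡ one N
B-zero N = ≡.trans (≡.sym (B≡ 0 N)) (Sums.B-0 N (ℕₚ.n<1+n N))
  where open Rogers N

A-suc : ∀ M N → A (suc M) N ≡
  A M N ℤ.+ ((mono (suc M) ⊛ A (suc M)) N ℤ.+ (mono (suc M) ⊛ B M) N)
A-suc M N = begin
  A (suc M) N       ≡⟨ A≡ (suc M) N ⟨
  Sums.A (suc M) N  ≡⟨ Sums.A-suc M N (ℕₚ.n<1+n N) ⟩
  Sums.A M N ℤ.+ ((mono (suc M) ⊛ Sums.A (suc M)) N ℤ.+ (mono (suc M) ⊛ Sums.B M) N)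
    ≡⟨ ≡.cong₂ ℤ._+_ (A≡ M N) (≡.cong₂ ℤ._+_ (mono-⊛-A≡ (suc M) (suc M) N) (mono-⊛-B≡ (suc M) M N)) ⟩
  A M N ℤ.+ ((mono (suc M) ⊛ A (suc M)) N ℤ.+ (mono (suc M) ⊛ B M) N) ∎
  where
  open Rogers N
  open ≡.≡-Reasoning

B-suc : ∀ M N → B (suc M) N ≡ B M N ℤ.+ (mono (suc M) ⊛ A (suc M)) N
B-suc M N = begin
  B (suc M) N       ≡⟨ B≡ (suc M) N ⟨
  Sums.B (suc M) N  ≡⟨ Sums.B-suc M N (ℕₚ.n<1+n N) ⟩
  Sums.B M N ℤ.+ (mono (suc M) ⊛ Sums.A (suc M)) N
    ≡⟨ ≡.cong₂ ℤ._+_ (B≡ M N) (mono-⊛-A≡ (suc M) (suc M) N) ⟩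
  B M N ℤ.+ (mono (suc M) ⊛ A (suc M)) N ∎
  where
  open Rogers N
  open ≡.≡-Reasoning

A≡rhs41 : ∀ N → A N N ≡ rhs41 N
A≡rhs41 N = begin
  A N N
    ≡⟨ A≡ N N ⟨
  Sums.A N N
    ≡⟨ Limit.A-limit N (ℕₚ.n<1+n N) ⟨
  (S ⊛ P N ⊛ V N) N
    ≡⟨ *-cong (*-cong S≡ P≡) V≡ N (ℕₚ.n<1+n N) ⟩
  rhs41 N ∎
  where
  open Rogers N
  open CommutativeRing (Truncated (suc N)) using (_≈_; *-cong; *-congˡ; trans; sym)
  open ≡.≡-Reasoning

  S : Series
  S = Sequences.∑ (Truncated (suc N)) (λ n → mono (n ℕ.* n) ⊛ I n) (suc N)

  summand-< : ∀ k n → k < n → (mono (n ℕ.* n) ⊛ I n) k ≡ + 0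
  summand-< k n k<n = mono-⊛-< (I n) (ℕₚ.<-≤-trans k<n (Limit.square-≥ n))

  S≡ : S ≈ sumInf (λ n → mono (n ℕ.* n) ⊛ I n)
  S≡ k (s≤s k≤N) = begin
    S k
      ≡⟨ ∑-coefficient (suc N) (λ n → mono (n ℕ.* n) ⊛ I n) (suc N) k ⟩
    sumTo (λ n → (mono (n ℕ.* n) ⊛ I n) k) (suc N)
      ≡⟨ sumTo≡∑ _ (suc N) ⟩
    ℤ-Seq.∑ (λ n → (mono (n ℕ.* n) ⊛ I n) k) (suc N)
      ≡⟨ ℤ-Seq.∑-extend (suc N) (s≤s k≤N) (summand-< k) ⟨
    ℤ-Seq.∑ (λ n → (mono (n ℕ.* n) ⊛ I n) k) (suc k)
      ≡⟨ sumTo≡∑ _ (suc k) ⟨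
    sumInf (λ n → mono (n ℕ.* n) ⊛ I n) k ∎

  P≡ : P N ≈ pochInf (neg (mono 2)) (mono 2)
  P≡ k (s≤s k≤N) = ≡.sym (pochInf≡poch (neg (mono 2)) (mono 2) (neg-mono-spow-small 2 (s≤s z≤n)) k≤N)

  Q≡ : Q N ≈ pochInf (mono 1) (mono 1)
  Q≡ k (s≤s k≤N) = ≡.sym (pochInf≡poch (mono 1) (mono 1) (mono-spow-small 1 (s≤s z≤n)) k≤N)

  Q∞ : Series
  Q∞ = pochInf (mono 1) (mono 1)

  -- `Q N` and `Q∞` agree only in the quotient; uniqueness of inverses there carries this over to
  -- their reciprocals.
  V≡ : V N ≈ inv Q∞
  V≡ = Inverses.inverse-unique (Truncated (suc N)) {V N} {inv Q∞} {Q N}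
    (λ k _ → V-inverse N k)
    (trans {inv Q∞ ⊛ Q N} {inv Q∞ ⊛ Q∞} {one}
      (*-congˡ {inv Q∞} {Q N} {Q∞} Q≡) (λ k _ → inv-⊛ Q∞ ≡.refl k))

-- Counting by explicit duplicate-free lists.

record Counts {X : Set} (P : X → Set) (n : ℤ) : Set where
  constructor counts
  field
    members  : List X
    sound    : All P members
    unique   : Unique members
    complete : ∀ x → P x → x ∈ members
    size     : + length members ≡ n

module _ {X : Set} where

  Counts-resp : ∀ {P R : X → Set} {m n} → (∀ {x} → P x → R x) → (∀ {x} → R x → P x) → m ≡ n →
    Counts P m → Counts R n
  Counts-resp to from eq (counts L s u c e) =
    counts L (All.map to s) u (λ x → c x ∘ from) (≡.trans e eq)

  Counts-∅ : ∀ {P : X → Set} → (∀ x → ¬ P x) → Counts P (+ 0)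
  Counts-∅ ¬P = counts List.[] All.[] AllPairs.[] (λ x p → ⊥-elim (¬P x p)) ≡.refl

  Counts-singleton : ∀ {P : X → Set} x → P x → (∀ y → P y → y ≡ x) → Counts P (+ 1)
  Counts-singleton x px only =
    counts List.[ x ] (px All.∷ All.[]) (All.[] AllPairs.∷ AllPairs.[]) (λ y → here ∘ only y) ≡.refl

  Counts-⊎ : ∀ {P R : X → Set} {m n} → (∀ {x} → P x → R x → ⊥) →
    Counts P m → Counts R n → Counts (λ x → P x ⊎ R x) (m ℤ.+ n)
  Counts-⊎ disjoint (counts L s u c ≡.refl) (counts L′ s′ u′ c′ ≡.refl) = counts
    (L List.++ L′)
    (Allₚ.++⁺ (All.map inj₁ s) (All.map inj₂ s′))
    (Uniqueₚ.++⁺ u u′ λ (x∈L , x∈L′) → disjoint (All.lookup s x∈L) (All.lookup s′ x∈L′))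
    (λ x → [ ∈ₚ.∈-++⁺ˡ ∘ c x , ∈ₚ.∈-++⁺ʳ L ∘ c′ x ]′)
    (≡.cong +_ (Listₚ.length-++ L))

Image : {X Y : Set} → (X → Y) → (X → Set) → Y → Set
Image f P y = ∃ λ x → P x × y ≡ f x

Counts-Image : ∀ {X Y : Set} {P : X → Set} {n} {f : X → Y} → (∀ {x y} → f x ≡ f y → x ≡ y) →
  Counts P n → Counts (Image f P) n
Counts-Image {f = f} injective (counts L s u c e) = counts
  (List.map f L)
  (Allₚ.map⁺ (All.map (λ p → _ , p , ≡.refl) s))
  (Uniqueₚ.map⁺ injective u)
  (λ { _ (x , px , ≡.refl) → ∈ₚ.∈-map⁺ f (c x px) })
  (≡.trans (≡.cong +_ (Listₚ.length-map f L)) e)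

Shifted : {X Y : Set} → ℕ → (X → Y) → (ℕ → X → Set) → ℕ → Y → Set
Shifted k f C N y = ∃ λ n → k ℕ.+ n ≡ N × Image f (C n) y

-- Coefficient N of q^k a is a_{N-k}, or 0 when k > N. Counts are required only at the n with k + n
-- = N, so that a recursion on the size can supply them.
Counts-Shifted : ∀ {X Y : Set} k {C : ℕ → X → Set} {a : Series} {f : X → Y} N →
  (∀ {x y} → f x ≡ f y → x ≡ y) → (∀ n → k ℕ.+ n ≡ N → Counts (C n) (a n)) →
  Counts (Shifted k f C N) ((mono k ⊛ a) N)
Counts-Shifted k {C} {a} {f} N injective cs with k ℕ.≤? N
... | no k≰N = Counts-resp ⊥-elim (λ { (n , ≡.refl , _) → k≰N (ℕₚ.m≤m+n k n) })
  (≡.sym (mono-⊛-< a (ℕₚ.≰⇒> k≰N))) (Counts-∅ λ _ ())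
... | yes k≤N with n ← N ∸ k | ≡.refl ← ℕₚ.m+[n∸m]≡n k≤N =
  Counts-resp (λ i → n , ≡.refl , i)
    (λ { (n′ , eq , i) → ≡.subst (λ m → Image f (C m) _) (ℕₚ.+-cancelˡ-≡ k n′ n eq) i })
    (≡.sym (mono-⊛-+ k a n)) (Counts-Image injective (cs n ≡.refl))

-- Partitions and the inequalities of a two-part profile.

IsPartition-∷⁺ : ∀ {x l} → 0 < x → part l 0 ≤ x → IsPartition l → IsPartition (x List.∷ l)
IsPartition-∷⁺ {l = List.[]}    0<x _   (_ , pos)   = Linked.[-] , 0<x All.∷ pos
IsPartition-∷⁺ {l = y List.∷ l} 0<x y≤x (ln , pos) = (y≤x Linked.∷ ln) , 0<x All.∷ pos

IsPartition-∷⁻ : ∀ {x l} → IsPartition (x List.∷ l) → part l 0 ≤ x × IsPartition l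
IsPartition-∷⁻ (Linked.[-] , _ All.∷ pos)          = z≤n , Linked.[] , pos
IsPartition-∷⁻ ((y≤x Linked.∷ ln) , _ All.∷ pos) = y≤x , ln , pos

part-antitone : ∀ {l} → IsPartition l → ∀ j → part l j ≤ part l 0
part-antitone {List.[]}    p j       = z≤n
part-antitone {x List.∷ l} p zero    = ℕₚ.≤-refl
part-antitone {x List.∷ l} p (suc j) =
  ℕₚ.≤-trans (part-antitone (proj₂ (IsPartition-∷⁻ p)) j) (proj₁ (IsPartition-∷⁻ p))

part-zero⇒[] : ∀ {l} → IsPartition l → part l 0 ≤ 0 → l ≡ List.[]
part-zero⇒[] {List.[]}    _                _ = ≡.refl
part-zero⇒[] {_ List.∷ _} (_ , pos All.∷ _) z = ⊥-elim (ℕₚ.<⇒≱ pos z)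

part≤sum : ∀ l → part l 0 ≤ sumℕ l
part≤sum List.[]       = z≤n
part≤sum (x List.∷ l) = ℕₚ.m≤m+n x (sumℕ l)

largest-part : ∀ {M} l → part l 0 ≡ suc M → ∃ λ l′ → l ≡ suc M List.∷ l′
largest-part (_ List.∷ l′) ≡.refl = l′ , ≡.refl

-- The inequalities of profile (a,b); a cons on the left raises a and lowers b by one.
record Interlacing (a b : ℕ) (l m : List ℕ) : Set where
  constructor interlacing
  field
    right≤left : ∀ j → part m (b ℕ.+ j) ≤ part l j
    left≤right : ∀ j → part l (a ℕ.+ j) ≤ part m j
open Interlacing

Interlacing-swap : ∀ {a b l m} → Interlacing a b l m → Interlacing b a m l
Interlacing-swap (interlacing h h′) = interlacing h′ h

-- The inequalities `left≤right` carry over unchanged, because the index `suc a + j` steps past the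
-- head by computation; for this the offset is written first. The others are those of index j + 1.
Interlacing-∷⁻ : ∀ {a b x l m} → Interlacing (suc a) b (x List.∷ l) m → Interlacing a (suc b) l m
Interlacing-∷⁻ {b = b} {l = l} {m} (interlacing h h′) =
  interlacing (λ j → ≡.subst (λ i → part m i ≤ part l j) (ℕₚ.+-suc b j) (h (suc j))) h′

-- Only the inequality against the new head, `part m b ≤ x`, is not inherited.
Interlacing-∷⁺ : ∀ {a b x l m} → part m b ≤ x → Interlacing a (suc b) l m →
  Interlacing (suc a) b (x List.∷ l) m
Interlacing-∷⁺ {b = b} {x} {l} {m} m≤x (interlacing h h′) = interlacing
  (λ { zero    → ≡.subst (λ i → part m i ≤ x) (≡.sym (ℕₚ.+-identityʳ b)) m≤x
     ; (suc j) → ≡.subst (λ i → part m i ≤ part l j) (≡.sym (ℕₚ.+-suc b j)) (h j) })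
  h′

-- Bounded cylindric partitions and removal of a largest part.

data Cyl (a b M N : ℕ) : Vec (List ℕ) 2 → Set where
  cyl : ∀ {l m} → IsPartition l → IsPartition m → Interlacing a b l m →
    part l 0 ≤ M → part m 0 ≤ M → sumℕ l ℕ.+ sumℕ m ≡ N → Cyl a b M N (l ∷ m ∷ [])

Cyl-weaken : ∀ {a b M N Λ} → Cyl a b M N Λ → Cyl a b (suc M) N Λ
Cyl-weaken (cyl pl pm i l≤ m≤ s) = cyl pl pm i (ℕₚ.m≤n⇒m≤1+n l≤) (ℕₚ.m≤n⇒m≤1+n m≤) s

consˡ consˡ-swap consʳ : ℕ → Vec (List ℕ) 2 → Vec (List ℕ) 2
consˡ x (l ∷ m ∷ []) = (x List.∷ l) ∷ m ∷ []
consˡ-swap x (m ∷ l ∷ []) = (x List.∷ l) ∷ m ∷ []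
consʳ x (l ∷ m ∷ []) = l ∷ (x List.∷ m) ∷ []

consˡ-injective : ∀ x {Λ Λ′} → consˡ x Λ ≡ consˡ x Λ′ → Λ ≡ Λ′
consˡ-injective x {_ ∷ _ ∷ []} {_ ∷ _ ∷ []} ≡.refl = ≡.refl

consˡ-swap-injective : ∀ x {Λ Λ′} → consˡ-swap x Λ ≡ consˡ-swap x Λ′ → Λ ≡ Λ′
consˡ-swap-injective x {_ ∷ _ ∷ []} {_ ∷ _ ∷ []} ≡.refl = ≡.refl

consʳ-injective : ∀ x {Λ Λ′} → consʳ x Λ ≡ consʳ x Λ′ → Λ ≡ Λ′
consʳ-injective x {_ ∷ _ ∷ []} {_ ∷ _ ∷ []} ≡.refl = ≡.refl

Cyl-zero : ∀ a b N → Counts (Cyl a b 0 N) (one N)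
Cyl-zero a b zero = Counts-singleton (List.[] ∷ List.[] ∷ [])
  (cyl empty empty (interlacing (λ _ → z≤n) (λ _ → z≤n)) z≤n z≤n ≡.refl)
  λ { _ (cyl pl pm _ l≤ m≤ _) → ≡.cong₂ (λ l m → l ∷ m ∷ []) (part-zero⇒[] pl l≤) (part-zero⇒[] pm m≤) }
  where
  empty : IsPartition List.[]
  empty = Linked.[] , All.[]
Cyl-zero a b (suc N) = Counts-∅
  λ { _ (cyl pl pm _ l≤ m≤ s) → impossible (part-zero⇒[] pl l≤) (part-zero⇒[] pm m≤) s }
  where
  impossible : ∀ {l m} → l ≡ List.[] → m ≡ List.[] → sumℕ l ℕ.+ sumℕ m ≡ suc N → ⊥
  impossible ≡.refl ≡.refl ()

size-∷ʳ : ∀ x y z → x ℕ.+ (y ℕ.+ z) ≡ y ℕ.+ (x ℕ.+ z)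
size-∷ʳ x y z = ≡.trans (≡.sym (ℕₚ.+-assoc x y z))
  (≡.trans (≡.cong (ℕ._+ z) (ℕₚ.+-comm x y)) (ℕₚ.+-assoc y x z))

size-∷ˡ : ∀ x y z → x ℕ.+ (y ℕ.+ z) ≡ (x ℕ.+ z) ℕ.+ y
size-∷ˡ x y z = ≡.trans (size-∷ʳ x y z) (ℕₚ.+-comm y (x ℕ.+ z))

-- A partition of profile (2,1) with an entry M+1 loses it from the first component if
-- possible, which yields profile (1,2), and otherwise from the second one, which yields (3,0).
Cyl21-cases : ℕ → ℕ → Vec (List ℕ) 2 → Set
Cyl21-cases M N Λ = Cyl 2 1 M N Λ ⊎
  (Shifted (suc M) (consˡ-swap (suc M)) (Cyl 2 1 (suc M)) N Λ ⊎
   Shifted (suc M) (consʳ (suc M)) (Cyl 3 0 M) N Λ)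

Cyl21-split : ∀ {M N Λ} → Cyl 2 1 (suc M) N Λ → Cyl21-cases M N Λ
Cyl21-split {M} (cyl {l} {m} pl pm i l≤ m≤ s) with ℕₚ.m≤n⇒m<n∨m≡n l≤ | ℕₚ.m≤n⇒m<n∨m≡n m≤
... | inj₁ (s≤s l≤M) | inj₁ (s≤s m≤M) = inj₁ (cyl pl pm i l≤M m≤M s)
-- The rest `l′` may begin with `suc M` again, so the bound stays and only the size drops.
... | inj₂ l≡ | _ with l′ , ≡.refl ← largest-part l l≡ =
  inj₂ (inj₁ (sumℕ m ℕ.+ sumℕ l′ , ≡.trans (size-∷ˡ (suc M) (sumℕ m) (sumℕ l′)) s
    , (m ∷ l′ ∷ []) , cyl pm (proj₂ (IsPartition-∷⁻ pl)) (Interlacing-swap (Interlacing-∷⁻ i))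
        m≤ (proj₁ (IsPartition-∷⁻ pl)) ≡.refl , ≡.refl))
... | inj₁ (s≤s l≤M) | inj₂ m≡ with m′ , ≡.refl ← largest-part m m≡ =
  inj₂ (inj₂ (sumℕ l ℕ.+ sumℕ m′ , ≡.trans (size-∷ʳ (suc M) (sumℕ l) (sumℕ m′)) s
    , (l ∷ m′ ∷ []) , cyl pl (proj₂ (IsPartition-∷⁻ pm)) i′
        -- Here the bound does drop: profile (3,0) forces `m′` below `l` entry by entry, and `l` is
        -- bounded by `M`.
        l≤M (ℕₚ.≤-trans (right≤left i′ 0) l≤M) ≡.refl , ≡.refl))
  where
  i′ : Interlacing 3 0 l m′
  i′ = Interlacing-swap (Interlacing-∷⁻ {x = suc M} (Interlacing-swap i))

Cyl21-join : ∀ {M N Λ} → Cyl21-cases M N Λ → Cyl 2 1 (suc M) N Λ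
Cyl21-join (inj₁ c) = Cyl-weaken c
Cyl21-join {M} (inj₂ (inj₁ (_ , ≡.refl , _ , cyl {m} {l} pm pl i m≤ l≤ ≡.refl , ≡.refl))) =
  cyl (IsPartition-∷⁺ (s≤s z≤n) l≤ pl) pm
    (Interlacing-∷⁺ (ℕₚ.≤-trans (part-antitone pm 1) m≤) (Interlacing-swap i))
    ℕₚ.≤-refl m≤ (≡.sym (size-∷ˡ (suc M) (sumℕ m) (sumℕ l)))
Cyl21-join {M} (inj₂ (inj₂ (_ , ≡.refl , _ , cyl {l} {m} pl pm i l≤ m≤ ≡.refl , ≡.refl))) =
  cyl pl (IsPartition-∷⁺ (s≤s z≤n) (ℕₚ.m≤n⇒m≤1+n m≤) pm)
    (Interlacing-swap (Interlacing-∷⁺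
      (ℕₚ.≤-trans (part-antitone pl 2) (ℕₚ.m≤n⇒m≤1+n l≤)) (Interlacing-swap i)))
    (ℕₚ.m≤n⇒m≤1+n l≤) ℕₚ.≤-refl (≡.sym (size-∷ʳ (suc M) (sumℕ l) (sumℕ m)))

Cyl30-cases : ℕ → ℕ → Vec (List ℕ) 2 → Set
Cyl30-cases M N Λ = Cyl 3 0 M N Λ ⊎ Shifted (suc M) (consˡ (suc M)) (Cyl 2 1 (suc M)) N Λ

Cyl30-split : ∀ {M N Λ} → Cyl 3 0 (suc M) N Λ → Cyl30-cases M N Λ
Cyl30-split {M} (cyl {l} {m} pl pm i l≤ m≤ s) with ℕₚ.m≤n⇒m<n∨m≡n l≤
-- The zero in the profile bounds the second component by the first, so an entry `suc M` anywhere
-- forces one at the head of `l`.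
... | inj₁ (s≤s l≤M) = inj₁ (cyl pl pm i l≤M (ℕₚ.≤-trans (right≤left i 0) l≤M) s)
... | inj₂ l≡ with l′ , ≡.refl ← largest-part l l≡ =
  inj₂ (sumℕ l′ ℕ.+ sumℕ m , ≡.trans (≡.sym (ℕₚ.+-assoc (suc M) (sumℕ l′) (sumℕ m))) s
    , (l′ ∷ m ∷ []) , cyl (proj₂ (IsPartition-∷⁻ pl)) pm (Interlacing-∷⁻ {x = suc M} i)
        (proj₁ (IsPartition-∷⁻ pl)) m≤ ≡.refl , ≡.refl)

Cyl30-join : ∀ {M N Λ} → Cyl30-cases M N Λ → Cyl 3 0 (suc M) N Λ
Cyl30-join (inj₁ c) = Cyl-weaken c
Cyl30-join {M} (inj₂ (_ , ≡.refl , _ , cyl {l} {m} pl pm i l≤ m≤ ≡.refl , ≡.refl)) =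
  cyl (IsPartition-∷⁺ (s≤s z≤n) l≤ pl) pm (Interlacing-∷⁺ m≤ i)
    ℕₚ.≤-refl m≤ (ℕₚ.+-assoc (suc M) (sumℕ l) (sumℕ m))

Counts-Cyl : ∀ M → (∀ N → Counts (Cyl 2 1 M N) (A M N)) × (∀ N → Counts (Cyl 3 0 M N) (B M N))
Counts-Cyl zero =
    (λ N → ≡.subst (Counts _) (≡.sym (A-zero N)) (Cyl-zero 2 1 N))
  , (λ N → ≡.subst (Counts _) (≡.sym (B-zero N)) (Cyl-zero 3 0 N))
Counts-Cyl (suc M) with Counts-Cyl M
... | countsA , countsB = countsA′ , countsB′
  where
  countsA′ : ∀ N → Counts (Cyl 2 1 (suc M) N) (A (suc M) N)
  -- The unknown count at bound `suc M` occurs on both sides, but on the right at size smaller by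
  -- `suc M`, so strong induction on the size resolves it. The count for (3,0) at this bound can
  -- then use the result.
  countsA′ = <-rec _ λ N rec → Counts-resp Cyl21-join Cyl21-split (≡.sym (A-suc M N))
    (Counts-⊎
      (λ { (cyl _ _ _ l≤M _ _) (inj₁ (_ , _ , (_ ∷ _ ∷ []) , _ , ≡.refl)) → ℕₚ.<-irrefl ≡.refl l≤M
         ; (cyl _ _ _ _ m≤M _) (inj₂ (_ , _ , (_ ∷ _ ∷ []) , _ , ≡.refl)) → ℕₚ.<-irrefl ≡.refl m≤M })
      (countsA N)
      (Counts-⊎
        (λ { (_ , _ , (_ ∷ _ ∷ []) , _ , ≡.refl) (_ , _ , _ , cyl _ _ _ l≤M _ _ , ≡.refl) →
             ℕₚ.<-irrefl ≡.refl l≤M })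
        (Counts-Shifted (suc M) {a = A (suc M)} N (consˡ-swap-injective (suc M))
          λ { n ≡.refl → rec (ℕₚ.m<n+m n (s≤s z≤n)) })
        (Counts-Shifted (suc M) {a = B M} N (consʳ-injective (suc M)) λ n _ → countsB n)))

  countsB′ : ∀ N → Counts (Cyl 3 0 (suc M) N) (B (suc M) N)
  countsB′ N = Counts-resp Cyl30-join Cyl30-split (≡.sym (B-suc M N))
    (Counts-⊎
      (λ { (cyl _ _ _ l≤M _ _) (_ , _ , (_ ∷ _ ∷ []) , _ , ≡.refl) → ℕₚ.<-irrefl ≡.refl l≤M })
      (countsB N)
      (Counts-Shifted (suc M) {a = A (suc M)} N (consˡ-injective (suc M)) λ n _ → countsA′ n))

Cyl⇒IsCylindric : ∀ {a b M N Λ} → Cyl a b M N Λ → IsCylindric (a ∷ b ∷ []) Λ × sizeCyl Λ ≡ N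
Cyl⇒IsCylindric {a} {b} (cyl {l} {m} pl pm (interlacing h h′) _ _ s) =
  ( (λ { Fin.zero → pl ; (Fin.suc Fin.zero) → pm })
  , (λ { Fin.zero j             → ≡.subst (λ i → part m i ≤ part l j) (ℕₚ.+-comm b j) (h j)
       ; (Fin.suc Fin.zero) j → ≡.subst (λ i → part l i ≤ part m j) (ℕₚ.+-comm a j) (h′ j) }))
  , ≡.trans (≡.cong (sumℕ l ℕ.+_) (ℕₚ.+-identityʳ (sumℕ m))) s

-- No part exceeds the total size, so taking the bound equal to `N` loses nothing; this is why the
-- diagonal coefficient `A N N` is the one needed.
IsCylindric⇒Cyl : ∀ {a b N Λ} → IsCylindric (a ∷ b ∷ []) Λ × sizeCyl Λ ≡ N → Cyl a b N N Λ
IsCylindric⇒Cyl {a} {b} {_} {l ∷ m ∷ []} ((p , h) , ≡.refl) =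
  cyl (p Fin.zero) (p (Fin.suc Fin.zero))
    (interlacing
      (λ j → ≡.subst (λ i → part m i ≤ part l j) (ℕₚ.+-comm j b) (h Fin.zero j))
      (λ j → ≡.subst (λ i → part l i ≤ part m j) (ℕₚ.+-comm j a) (h (Fin.suc Fin.zero) j)))
    (ℕₚ.≤-trans (part≤sum l) (ℕₚ.m≤m+n _ _))
    (ℕₚ.≤-trans (part≤sum m) (ℕₚ.≤-trans (ℕₚ.m≤m+n _ 0) (ℕₚ.m≤n+m _ (sumℕ l))))
    (≡.cong (sumℕ l ℕ.+_) (≡.sym (ℕₚ.+-identityʳ (sumℕ m))))

theorem4p1 : (N : ℕ) →
    Σ (List (Vec (List ℕ) 2)) λ L →
    All (λ Λ → IsCylindric (2 ∷ 1 ∷ []) Λ × sizeCyl Λ ≡ N) L ×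
    Unique L ×
    ((Λ : Vec (List ℕ) 2) → IsCylindric (2 ∷ 1 ∷ []) Λ → sizeCyl Λ ≡ N → Λ ∈ L) ×
    (+ length L ≡ rhs41 N)
theorem4p1 N = members , sound , unique , (λ Λ c s → complete Λ (c , s)) , size
  where open Counts (Counts-resp Cyl⇒IsCylindric IsCylindric⇒Cyl (A≡rhs41 N) (proj₁ (Counts-Cyl N) N))
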